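{- Let $\mathcal{A}$ be a one-dimensional cellular automaton which is not sensitive to initial conditions, and let $\mu$ be any complete Bernoulli measure on $Q^{\mathbb{Z}}$. Then the set $L_\mu(\mathcal{A})$ of $\mu$-persistent words of $\mathcal{A}$ is exactly the set of bricks of wall for $\mathcal{A}$.
   Context: A one-dimensional cellular automaton (CA) $\mathcal{A}$ is given by a finite alphabet $Q$, a radius $r\ge 0$ and a local rule $\delta:Q^{2r+1}\to Q$; it acts on configurations $c\in Q^{\mathbb{Z}}$ by $\mathcal{A}(c)_i=\delta(c_{i-r},\dots,c_{i+r})$. For a word $u\in Q^*$ and $i\in\mathbb{Z}$, the cylinder is $[u]_i=\{c\in Q^{\mathbb{Z}}: c_ic_{i+1}\cdots c_{i+|u|-1}=u\}$. A Bernoulli measure $\mu$ on $Q^{\mathbb{Z}}$ is given by a probability vector $(p_a)_{a\in Q}$ with $\mu([u]_i)=\prod_{a\in Q}p_a^{|u|_a}$ for all $u,i$, where $|u|_a$ is the number of occurrences of $a$ in $u$; it is complete if $p_a>0$ for all $a$; the uniform measure has $p_a=1/|Q|$. For $n\ge0$, $\mathcal{A}^n\mu$ is the measure $U\mapsto\mu(\mathcal{A}^{ -n}(U))$. A word $u\in Q^*$ is vanishing for $(\mathcal{A},\mu)$ if $\lim_{n\to\infty}\mathcal{A}^n\mu([u]_0)=0$, and persistent otherwise; $L_\mu(\mathcal{A})$ denotes the set of persistent words. The $\mu$-limit set is $\Lambda_\mu(\mathcal{A})=\{c\in Q^{\mathbb{Z}}:\text{every finite subword of }c\text{ lies in }L_\mu(\mathcal{A})\}$.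 Walls: for $u\in Q^*$ let $\langle u\rangle=[u]_{ -|u|/2}$ if $|u|$ is even and $\langle u\rangle=[u]_{ -(|u|+1)/2}$ if $|u|$ is odd. A wall for $\mathcal{A}$ is a sequence $(w_n)_{n\ge0}$ of nonempty words over $Q$ such that (1) for every $c\in\langle w_0\rangle$ and every $n\ge1$, $\mathcal{A}^n(c)\in\langle w_n\rangle$, and (2) the sequence $(|w_n|)_{n\ge0}$ is non-increasing. The word $w_0$ is the foot of the wall. A word $w$ is a brick of the wall $(w_n)$ if there are integers $p\ge1$, $n_0\ge0$ with $w_{pn+n_0}=w$ for all $n\ge0$. A word is a brick of wall for $\mathcal{A}$ if it is a brick of some wall for $\mathcal{A}$. Sensitivity: equip $Q^{\mathbb{Z}}$ with the Cantor metric $d(c,c')=2^{ -\min\{|i|:c_i\neq c'_i\}}$. $\mathcal{A}$ is sensitive to initial conditions if there is $\varepsilon>0$ such that for every $c$ and every $\eta>0$ there exist $c'$ with $d(c,c')<\eta$ and $n\ge0$ with $d(\mathcal{A}^n(c),\mathcal{A}^n(c'))\ge\varepsilon$.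
   Formalization: The equality of the two sets is stated for nonempty words only: the empty word always has measure 1, hence is persistent, but it is never a brick of wall because walls consist of nonempty words. -}

module Defs where

open import Level using (0ℓ)
open import Data.Bool using (true; false; if_then_else_; _∧_)
open import Data.Fin as Fin using (Fin; toℕ)
open import Data.Integer as ℤ using (ℤ; +_)
import Data.Integer.Properties as ℤP
open import Data.List as List using (List; []; _∷_; length; lookup)
open import Data.Nat as ℕ using (ℕ; zero; suc; ⌈_/2⌉)
import Data.Nat.Properties as ℕP
open import Data.Product using (∃-syntax; _×_; _,_)
open import Data.Rational as ℚ using (ℚ; 0ℚ; 1ℚ; ½; ∣_∣)
import Data.Rational.Properties as ℚP
open import Data.Rational.Solver using (module +-*-Solver)
import Data.Rational.Unnormalised as ℚᵘ
import Data.Rational.Unnormalised.Properties as ℚᵘP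
open import Data.Sum using (_⊎_; inj₁; inj₂; [_,_]′)
open import Data.Unit using (⊤; tt)
open import Data.Vec as Vec using (Vec)
open import Function using (_∘_)
open import Relation.Binary.PropositionalEquality
  using (_≡_; _≢_; refl; sym; trans; cong; cong₂; subst; subst₂)
open import Relation.Nullary using (¬_; Dec; yes; no; does)
open import Relation.Unary using (Pred; _∈_; _≐_; _⊥_; _⊢_; ∁; ⋃; ⋂; _∪_; _∩_; U; ∅)

IsCauchy : (ℕ → ℚ) → Set
IsCauchy s = ∀ ε → 0ℚ ℚ.< ε →
  ∃[ N ] (∀ m n → N ℕ.≤ m → N ℕ.≤ n → ∣ s m ℚ.- s n ∣ ℚ.< ε)

record ℝ : Set where
  constructor mkℝ
  field
    seq    : ℕ → ℚ
    cauchy : IsCauchy seq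
open ℝ public

infix 4 _≃_ _<_ _≤_

-- _≃_, not _≡_, is equality of real numbers.
_≃_ : ℝ → ℝ → Set
x ≃ y = ∀ ε → 0ℚ ℚ.< ε → ∃[ N ] (∀ n → N ℕ.≤ n → ∣ seq x n ℚ.- seq y n ∣ ℚ.< ε)

_<_ : ℝ → ℝ → Set
x < y = ∃[ ε ] (0ℚ ℚ.< ε × ∃[ N ] (∀ n → N ℕ.≤ n → seq x n ℚ.+ ε ℚ.< seq y n))

_≤_ : ℝ → ℝ → Set
x ≤ y = ¬ (y < x)

module CauchyLemmas where
  d-self : ∀ p → ∣ p ℚ.- p ∣ ≡ 0ℚ
  d-self p rewrite ℚP.+-inverseʳ p = refl

  -ᵈ : ∀ a b → ℚ.- (a ℚ.- b) ≡ b ℚ.- a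
  -ᵈ = +-*-Solver.solve 2 (λ a b → :- (a :- b) := b :- a) refl
    where open +-*-Solver

  d-sym : ∀ a b → ∣ a ℚ.- b ∣ ≡ ∣ b ℚ.- a ∣
  d-sym a b = trans (sym (ℚP.∣-p∣≡∣p∣ (a ℚ.- b))) (cong ∣_∣ (-ᵈ a b))

  half-pos : ∀ {ε} → 0ℚ ℚ.< ε → 0ℚ ℚ.< ½ ℚ.* ε
  half-pos {ε} 0<ε = subst (ℚ._< ½ ℚ.* ε) (ℚP.*-zeroʳ ½) (ℚP.*-monoʳ-<-pos ½ 0<ε)

  halves : ∀ ε → ½ ℚ.* ε ℚ.+ ½ ℚ.* ε ≡ ε
  halves ε = trans (sym (ℚP.*-distribʳ-+ ε ½ ½)) (ℚP.*-identityˡ ε)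

  ∣∣-lip : ∀ a b → ∣ ∣ a ∣ ℚ.- ∣ b ∣ ∣ ℚ.≤ ∣ a ℚ.- b ∣
  ∣∣-lip a b = [ (λ e → subst (ℚ._≤ ∣ a ℚ.- b ∣) (sym e) (half a b))
               , (λ e → subst₂ ℚ._≤_ (trans (sym (-ᵈ ∣ a ∣ ∣ b ∣)) (sym e)) (d-sym b a) (half b a)) ]′
               (ℚP.∣p∣≡p∨∣p∣≡-p (∣ a ∣ ℚ.- ∣ b ∣))
    where
    lem : ∀ x y → (x ℚ.- y) ℚ.+ y ≡ x
    lem = +-*-Solver.solve 2 (λ x y → (x :- y) :+ y := x) refl
      where open +-*-Solver
    lem′ : ∀ x y → (x ℚ.+ y) ℚ.- y ≡ x
    lem′ = +-*-Solver.solve 2 (λ x y → (x :+ y) :- y := x) refl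
      where open +-*-Solver
    half : ∀ x y → ∣ x ∣ ℚ.- ∣ y ∣ ℚ.≤ ∣ x ℚ.- y ∣
    half x y = subst (∣ x ∣ ℚ.- ∣ y ∣ ℚ.≤_) (lem′ ∣ x ℚ.- y ∣ ∣ y ∣)
      (ℚP.+-monoˡ-≤ (ℚ.- ∣ y ∣)
        (subst (λ z → ∣ z ∣ ℚ.≤ ∣ x ℚ.- y ∣ ℚ.+ ∣ y ∣) (lem x y) (ℚP.∣p+q∣≤∣p∣+∣q∣ (x ℚ.- y) y)))

  bounded : ∀ s → IsCauchy s → ∃[ B ] (0ℚ ℚ.< B × (∀ n → ∣ s n ∣ ℚ.≤ B))
  bounded s cs with cs 1ℚ (ℚP.positive⁻¹ 1ℚ)
  ... | N , h = max N ℚ.+ (∣ s N ∣ ℚ.+ 1ℚ) , 0<B , bd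
    where
    max : ℕ → ℚ
    max zero    = 0ℚ
    max (suc k) = max k ℚ.⊔ ∣ s k ∣
    0≤max : ∀ k → 0ℚ ℚ.≤ max k
    0≤max zero    = ℚP.≤-refl
    0≤max (suc k) = ℚP.≤-trans (0≤max k) (ℚP.p≤p⊔q (max k) ∣ s k ∣)
    below : ∀ k n → n ℕ.< k → ∣ s n ∣ ℚ.≤ max k
    below (suc k) n (ℕ.s≤s n≤k) with ℕP.m≤n⇒m<n∨m≡n n≤k
    ... | inj₁ n<k  = ℚP.≤-trans (below k n n<k) (ℚP.p≤p⊔q (max k) ∣ s k ∣)
    ... | inj₂ refl = ℚP.p≤q⊔p (max k) ∣ s k ∣
    0<t : 0ℚ ℚ.< ∣ s N ∣ ℚ.+ 1ℚ
    0<t = ℚP.+-mono-≤-< (ℚP.0≤∣p∣ (s N)) (ℚP.positive⁻¹ 1ℚ)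
    0<B : 0ℚ ℚ.< max N ℚ.+ (∣ s N ∣ ℚ.+ 1ℚ)
    0<B = ℚP.+-mono-≤-< (0≤max N) 0<t
    lem : ∀ x y → y ℚ.+ (x ℚ.- y) ≡ x
    lem = +-*-Solver.solve 2 (λ x y → y :+ (x :- y) := x) refl
      where open +-*-Solver
    bd : ∀ n → ∣ s n ∣ ℚ.≤ max N ℚ.+ (∣ s N ∣ ℚ.+ 1ℚ)
    bd n with n ℕP.<? N
    ... | yes n<N = subst (ℚ._≤ _) (ℚP.+-identityʳ ∣ s n ∣)
                      (ℚP.+-mono-≤ (below N n n<N) (ℚP.<⇒≤ 0<t))
    ... | no  n≮N = subst (ℚ._≤ _) (ℚP.+-identityˡ ∣ s n ∣)
      (ℚP.+-mono-≤ (0≤max N)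
        (ℚP.≤-trans
          (subst (λ z → ∣ z ∣ ℚ.≤ ∣ s N ∣ ℚ.+ ∣ s n ℚ.- s N ∣) (lem (s n) (s N))
            (ℚP.∣p+q∣≤∣p∣+∣q∣ (s N) (s n ℚ.- s N)))
          (ℚP.+-monoʳ-≤ ∣ s N ∣ (ℚP.<⇒≤ (h n N (ℕP.≮⇒≥ n≮N) ℕP.≤-refl)))))

  +-cauchy : ∀ s t → IsCauchy s → IsCauchy t → IsCauchy (λ n → s n ℚ.+ t n)
  +-cauchy s t cs ct ε 0<ε with cs (½ ℚ.* ε) (half-pos 0<ε) | ct (½ ℚ.* ε) (half-pos 0<ε)
  ... | N , f | M , g = N ℕ.⊔ M , λ m n p q →
    subst₂ ℚ._<_ (cong ∣_∣ (lem (s m) (s n) (t m) (t n))) (halves ε)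
      (ℚP.≤-<-trans (ℚP.∣p+q∣≤∣p∣+∣q∣ (s m ℚ.- s n) (t m ℚ.- t n))
        (ℚP.+-mono-< (f m n (ℕP.m⊔n≤o⇒m≤o N M p) (ℕP.m⊔n≤o⇒m≤o N M q))
                     (g m n (ℕP.m⊔n≤o⇒n≤o N M p) (ℕP.m⊔n≤o⇒n≤o N M q))))
    where
    lem : ∀ a b c d → (a ℚ.- b) ℚ.+ (c ℚ.- d) ≡ (a ℚ.+ c) ℚ.- (b ℚ.+ d)
    lem = +-*-Solver.solve 4 (λ a b c d → (a :- b) :+ (c :- d) := (a :+ c) :- (b :+ d)) refl
      where open +-*-Solver

  neg-cauchy : ∀ s → IsCauchy s → IsCauchy (λ n → ℚ.- s n)
  neg-cauchy s cs ε 0<ε with cs ε 0<ε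
  ... | N , f = N , λ m n p q →
    subst (ℚ._< ε) (trans (sym (ℚP.∣-p∣≡∣p∣ (s m ℚ.- s n))) (cong ∣_∣ (lem (s m) (s n)))) (f m n p q)
    where
    lem : ∀ a b → ℚ.- (a ℚ.- b) ≡ (ℚ.- a) ℚ.- (ℚ.- b)
    lem = +-*-Solver.solve 2 (λ a b → :- (a :- b) := (:- a) :- (:- b)) refl
      where open +-*-Solver

  *-cauchy : ∀ s t → IsCauchy s → IsCauchy t → IsCauchy (λ n → s n ℚ.* t n)
  *-cauchy s t cs ct ε 0<ε with bounded s cs | bounded t ct
  ... | A , 0<A , a | B , 0<B , b = main
    where
    C = A ℚ.+ B
    0<C : 0ℚ ℚ.< C
    0<C = ℚP.+-mono-< 0<A 0<B
    instance
      posA : ℚ.Positive A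
      posA = ℚ.positive 0<A
      posB : ℚ.Positive B
      posB = ℚ.positive 0<B
      posC : ℚ.Positive C
      posC = ℚ.positive 0<C
      nzC : ℚ.NonZero C
      nzC = ℚP.pos⇒nonZero C
      posC⁻¹ : ℚ.Positive (ℚ.1/ C)
      posC⁻¹ = ℚP.1/pos⇒pos C
    δ = ε ℚ.* (ℚ.1/ C)
    0<δ : 0ℚ ℚ.< δ
    0<δ = subst (ℚ._< δ) (ℚP.*-zeroˡ (ℚ.1/ C)) (ℚP.*-monoˡ-<-pos (ℚ.1/ C) 0<ε)
    Cδ : A ℚ.* δ ℚ.+ B ℚ.* δ ≡ ε
    Cδ = trans (sym (ℚP.*-distribʳ-+ δ A B))
        (trans (cong (C ℚ.*_) (ℚP.*-comm ε (ℚ.1/ C)))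
        (trans (sym (ℚP.*-assoc C (ℚ.1/ C) ε))
        (trans (cong (ℚ._* ε) (ℚP.*-inverseʳ C)) (ℚP.*-identityˡ ε))))
    lem : ∀ u v x y → u ℚ.* (x ℚ.- y) ℚ.+ y ℚ.* (u ℚ.- v) ≡ u ℚ.* x ℚ.- v ℚ.* y
    lem = +-*-Solver.solve 4 (λ u v x y → u :* (x :- y) :+ y :* (u :- v) := u :* x :- v :* y) refl
      where open +-*-Solver
    bnd : ∀ x y K .{{_ : ℚ.Positive K}} → ∣ x ∣ ℚ.≤ K → ∣ y ∣ ℚ.< δ → ∣ x ℚ.* y ∣ ℚ.< K ℚ.* δ
    bnd x y K x≤K y<δ = subst (ℚ._< K ℚ.* δ) (sym (ℚP.∣p*q∣≡∣p∣*∣q∣ x y))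
      (ℚP.≤-<-trans
        (ℚP.*-monoʳ-≤-nonNeg ∣ y ∣ {{ℚP.∣-∣-nonNeg y}} x≤K)
        (ℚP.*-monoʳ-<-pos K y<δ))
    main : ∃[ N ] (∀ m n → N ℕ.≤ m → N ℕ.≤ n → ∣ s m ℚ.* t m ℚ.- s n ℚ.* t n ∣ ℚ.< ε)
    main with cs δ 0<δ | ct δ 0<δ
    ... | N , f | M , g = N ℕ.⊔ M , λ m n p q →
      subst₂ ℚ._<_ (cong ∣_∣ (lem (s m) (s n) (t m) (t n))) Cδ
        (ℚP.≤-<-trans (ℚP.∣p+q∣≤∣p∣+∣q∣ (s m ℚ.* (t m ℚ.- t n)) (t n ℚ.* (s m ℚ.- s n)))
          (ℚP.+-mono-<
            (bnd (s m) (t m ℚ.- t n) A (a m) (g m n (ℕP.m⊔n≤o⇒n≤o N M p) (ℕP.m⊔n≤o⇒n≤o N M q)))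
            (bnd (t n) (s m ℚ.- s n) B (b n) (f m n (ℕP.m⊔n≤o⇒m≤o N M p) (ℕP.m⊔n≤o⇒m≤o N M q)))))

open CauchyLemmas

fromℚ : ℚ → ℝ
fromℚ p = mkℝ (λ _ → p) (λ ε 0<ε → 0 , λ _ _ _ _ → subst (ℚ._< ε) (sym (d-self p)) 0<ε)

0ℝ 1ℝ : ℝ
0ℝ = fromℚ 0ℚ
1ℝ = fromℚ 1ℚ

infixl 6 _+_ _-_
infixl 7 _*_
infixr 8 _^_

_+_ : ℝ → ℝ → ℝ
mkℝ s cs + mkℝ t ct = mkℝ (λ n → s n ℚ.+ t n) (+-cauchy s t cs ct)

-_ : ℝ → ℝ
- mkℝ s cs = mkℝ (λ n → ℚ.- s n) (neg-cauchy s cs)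

_-_ : ℝ → ℝ → ℝ
x - y = x + (- y)

_*_ : ℝ → ℝ → ℝ
mkℝ s cs * mkℝ t ct = mkℝ (λ n → s n ℚ.* t n) (*-cauchy s t cs ct)

abs : ℝ → ℝ
abs (mkℝ s cs) = mkℝ (λ n → ∣ s n ∣) λ ε 0<ε →
  let (N , f) = cs ε 0<ε in
  N , λ m n p q → ℚP.≤-<-trans (∣∣-lip (s m) (s n)) (f m n p q)

_^_ : ℝ → ℕ → ℝ
x ^ zero  = 1ℝ
x ^ suc n = x * x ^ n

sum product : List ℝ → ℝ
sum     = List.foldr _+_ 0ℝ
product = List.foldr _*_ 1ℝ

infix 4 _⟶_

_⟶_ : (ℕ → ℝ) → ℝ → Set
s ⟶ x = ∀ ε → 0ℝ < ε → ∃[ N ] (∀ n → N ℕ.≤ n → abs (s n - x) < ε)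

-- The alphabet Q is Fin q.

Word : ℕ → Set
Word q = List (Fin q)

Config : ℕ → Set
Config q = ℤ → Fin q

[_]at_ : ∀ {q} → Word q → ℤ → Pred (Config q) 0ℓ
([ u ]at i) c = ∀ (k : Fin (length u)) → c (i ℤ.+ + toℕ k) ≡ lookup u k

½^ : ℕ → ℚ
½^ zero    = 1ℚ
½^ (suc n) = ½ ℚ.* ½^ n

-- Looks for the first k in { m , … , m + n - 1 } at which c and c′ differ in
-- position k or -k; the value is 2⁻ᵏ, or 0 if there is no such k.
diff : ∀ {q} → Config q → Config q → ℕ → ℕ → ℚ
diff c c′ m zero    = 0ℚ
diff c c′ m (suc n) =
  if does (c (+ m) Fin.≟ c′ (+ m)) ∧ does (c (ℤ.- + m) Fin.≟ c′ (ℤ.- + m))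
  then diff c c′ (suc m) n
  else ½^ m

module DistanceLemmas where
  ½^>0 : ∀ n → 0ℚ ℚ.< ½^ n
  ½^>0 zero    = ℚP.positive⁻¹ 1ℚ
  ½^>0 (suc n) = half-pos (½^>0 n)

  ½^-step : ∀ n → ½^ (suc n) ℚ.≤ ½^ n
  ½^-step n = subst (½^ (suc n) ℚ.≤_) (halves (½^ n))
    (subst (ℚ._≤ ½^ (suc n) ℚ.+ ½^ (suc n)) (ℚP.+-identityʳ (½^ (suc n)))
      (ℚP.+-monoʳ-≤ (½^ (suc n)) (ℚP.<⇒≤ (½^>0 (suc n)))))

  ½^-anti : ∀ m n → ½^ (m ℕ.+ n) ℚ.≤ ½^ n
  ½^-anti zero    n = ℚP.≤-refl
  ½^-anti (suc m) n = ℚP.≤-trans (½^-step (m ℕ.+ n)) (½^-anti m n)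

  ι : ℕ → ℚ
  ι zero    = 0ℚ
  ι (suc n) = 1ℚ ℚ.+ ι n

  ι-½^ : ∀ n → ι n ℚ.* ½^ n ℚ.< 1ℚ
  ι-½^ zero    = ℚP.positive⁻¹ 1ℚ
  ι-½^ (suc n) = subst₂ ℚ._<_ (sym (lem (ι n) (½^ n))) (halves 1ℚ)
    (ℚP.+-mono-≤-<
      (ℚP.*-monoˡ-≤-nonNeg ½ (subst (λ k → ½^ k ℚ.≤ 1ℚ) (ℕP.+-identityʳ n) (½^-anti n 0)))
      (ℚP.*-monoʳ-<-pos ½ (ι-½^ n)))
    where
    lem : ∀ x y → (1ℚ ℚ.+ x) ℚ.* (½ ℚ.* y) ≡ ½ ℚ.* y ℚ.+ ½ ℚ.* (x ℚ.* y)
    lem = +-*-Solver.solve 2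
      (λ x y → (con 1ℚ :+ x) :* (con ½ :* y) := con ½ :* y :+ con ½ :* (x :* y)) refl
      where open +-*-Solver

  0≤ι : ∀ n → 0ℚ ℚ.≤ ι n
  0≤ι zero    = ℚP.≤-refl
  0≤ι (suc n) = ℚP.+-mono-≤ (ℚP.<⇒≤ (ℚP.positive⁻¹ 1ℚ)) (0≤ι n)

  ιᵘ : ∀ n → ℚ.toℚᵘ (ι n) ℚᵘ.≃ ℚᵘ.mkℚᵘ (+ n) 0
  ιᵘ zero    = ℚᵘ.*≡* refl
  ιᵘ (suc n) = ℚᵘP.≃-trans (ℚP.toℚᵘ-homo-+ 1ℚ (ι n))
    (ℚᵘP.≃-trans (ℚᵘP.+-cong (ℚᵘP.≃-refl {ℚᵘ.1ℚᵘ}) (ιᵘ n))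
      (ℚᵘ.*≡* (cong (λ z → (+ 1 ℤ.+ z) ℤ.* + 1) (ℤP.*-identityʳ (+ n)))))

  archimedean : ∀ ε → 0ℚ ℚ.< ε → ∃[ n ] (1ℚ ℚ.≤ ε ℚ.* ι n)
  archimedean (ℚ.mkℚ (+ suc a) b cop) 0<ε = suc b , ℚP.toℚᵘ-cancel-≤
    (ℚᵘP.≤-respʳ-≃
      (ℚᵘP.≃-sym (ℚᵘP.≃-trans (ℚP.toℚᵘ-homo-* ε (ι (suc b))) (ℚᵘP.*-congˡ {ℚ.toℚᵘ ε} (ιᵘ (suc b)))))
      (ℚᵘ.*≤* (subst₂ ℤ._≤_ e₁ e₂ (ℤ.+≤+ (ℕP.m≤m+n (suc b) (a ℕ.* suc b))))))
    where
    ε = ℚ.mkℚ (+ suc a) b cop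
    e₁ : + suc b ≡ + 1 ℤ.* (+ suc (b ℕ.* 1))
    e₁ = trans (cong (λ z → + suc z) (sym (ℕP.*-identityʳ b))) (sym (ℤP.*-identityˡ _))
    e₂ : + (suc a ℕ.* suc b) ≡ (+ suc a ℤ.* + suc b) ℤ.* + 1
    e₂ = trans (ℤP.pos-* (suc a) (suc b)) (sym (ℤP.*-identityʳ _))
  archimedean (ℚ.mkℚ (+ zero) b cop) (ℚ.*<* (ℤ.+<+ ()))
  archimedean (ℚ.mkℚ (ℤ.-[1+ a ]) b cop) (ℚ.*<* ())

  ½^-small : ∀ ε → 0ℚ ℚ.< ε → ∃[ n ] (½^ n ℚ.< ε)
  ½^-small ε 0<ε with archimedean ε 0<ε
  ... | n , h = n , ℚP.*-cancelʳ-<-nonNeg (ι n) {{ℚ.nonNegative (0≤ι n)}}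
    (ℚP.<-≤-trans (subst (ℚ._< 1ℚ) (ℚP.*-comm (ι n) (½^ n)) (ι-½^ n)) h)

  diff≥0 : ∀ {q} (c c′ : Config q) m n → 0ℚ ℚ.≤ diff c c′ m n
  diff≥0 c c′ m zero    = ℚP.≤-refl
  diff≥0 c c′ m (suc n)
    with does (c (+ m) Fin.≟ c′ (+ m)) ∧ does (c (ℤ.- + m) Fin.≟ c′ (ℤ.- + m))
  ... | true  = diff≥0 c c′ (suc m) n
  ... | false = ℚP.<⇒≤ (½^>0 m)

  diff≤ : ∀ {q} (c c′ : Config q) m n → diff c c′ m n ℚ.≤ ½^ m
  diff≤ c c′ m zero    = ℚP.<⇒≤ (½^>0 m)
  diff≤ c c′ m (suc n)
    with does (c (+ m) Fin.≟ c′ (+ m)) ∧ does (c (ℤ.- + m) Fin.≟ c′ (ℤ.- + m))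
  ... | true  = ℚP.≤-trans (diff≤ c c′ (suc m) n) (½^-step m)
  ... | false = ℚP.≤-refl

  within : ∀ {x y b} → 0ℚ ℚ.≤ x → x ℚ.≤ b → 0ℚ ℚ.≤ y → y ℚ.≤ b → ∣ x ℚ.- y ∣ ℚ.≤ b
  within {x} {y} {b} 0≤x x≤b 0≤y y≤b =
    [ (λ e → subst (ℚ._≤ b) (sym e) (half 0≤y x≤b))
    , (λ e → subst (ℚ._≤ b) (trans (sym (-ᵈ x y)) (sym e)) (half 0≤x y≤b)) ]′
    (ℚP.∣p∣≡p∨∣p∣≡-p (x ℚ.- y))
    where
    half : ∀ {u v} → 0ℚ ℚ.≤ v → u ℚ.≤ b → u ℚ.- v ℚ.≤ b
    half {u} {v} 0≤v u≤b = subst (u ℚ.- v ℚ.≤_) (ℚP.+-identityʳ b)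
      (ℚP.+-mono-≤ u≤b (ℚP.neg-antimono-≤ 0≤v))

  diff-close : ∀ {q} (c c′ : Config q) N m k n → N ℕ.≤ k → N ℕ.≤ n →
               ∣ diff c c′ m k ℚ.- diff c c′ m n ∣ ℚ.≤ ½^ (m ℕ.+ N)
  diff-close c c′ zero m k n _ _ =
    subst (λ z → ∣ diff c c′ m k ℚ.- diff c c′ m n ∣ ℚ.≤ ½^ z) (sym (ℕP.+-identityʳ m))
      (within (diff≥0 c c′ m k) (diff≤ c c′ m k) (diff≥0 c c′ m n) (diff≤ c c′ m n))
  diff-close c c′ (suc N) m (suc k) (suc n) (ℕ.s≤s p) (ℕ.s≤s r)
    with does (c (+ m) Fin.≟ c′ (+ m)) ∧ does (c (ℤ.- + m) Fin.≟ c′ (ℤ.- + m))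
  ... | true  =
    subst (λ z → ∣ diff c c′ (suc m) k ℚ.- diff c c′ (suc m) n ∣ ℚ.≤ ½^ z) (sym (ℕP.+-suc m N))
      (diff-close c c′ N (suc m) k n p r)
  ... | false =
    subst (ℚ._≤ ½^ (m ℕ.+ suc N)) (sym (d-self (½^ m))) (ℚP.<⇒≤ (½^>0 (m ℕ.+ suc N)))

open DistanceLemmas

-- The sequence is constant from n = k + 1 on if k is the least ∣i∣ with
-- c i ≢ c′ i, and constantly 0 if c and c′ agree everywhere.
d : ∀ {q} → Config q → Config q → ℝ
d c c′ = mkℝ (diff c c′ 0) λ ε 0<ε →
  let (N , h) = ½^-small ε 0<ε in
  N , λ k n p r → ℚP.≤-<-trans (diff-close c c′ N 0 k n p r) h

record CellularAutomaton (q : ℕ) : Set where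
  field
    radius : ℕ
    rule   : Vec (Fin q) (2 ℕ.* radius ℕ.+ 1) → Fin q

  step : Config q → Config q
  step c i = rule (Vec.tabulate λ k → c (i ℤ.- + radius ℤ.+ + toℕ k))

  steps : ℕ → Config q → Config q
  steps zero    c = c
  steps (suc n) c = step (steps n c)

open CellularAutomaton public

Sensitive : ∀ {q} → CellularAutomaton q → Set
Sensitive 𝓐 =
  ∃[ ε ] (0ℝ < ε ×
    (∀ c η → 0ℝ < η →
      ∃[ c′ ] (d c c′ < η × ∃[ n ] (ε ≤ d (steps 𝓐 n c) (steps 𝓐 n c′)))))

-- Closure under countable intersections is listed because it does not follow
-- constructively from closure under complements and countable unions.
data Borel {q : ℕ} : Pred (Config q) 0ℓ → Set₁ where
  cylinder : ∀ u i → Borel ([ u ]at i)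
  ∁ᴮ       : ∀ {A} → Borel A → Borel (∁ A)
  ⋃ᴮ       : ∀ {A : ℕ → Pred (Config q) 0ℓ} → (∀ n → Borel (A n)) → Borel (⋃ ℕ A)
  ⋂ᴮ       : ∀ {A : ℕ → Pred (Config q) 0ℓ} → (∀ n → Borel (A n)) → Borel (⋂ ℕ A)
  resp     : ∀ {A B} → A ≐ B → Borel A → Borel B

record ProbabilityMeasure (q : ℕ) : Set₁ where
  field
    measure    : ∀ {A : Pred (Config q) 0ℓ} → Borel A → ℝ
    ext        : ∀ {A B} (a : Borel A) (b : Borel B) → A ≐ B → measure a ≃ measure b
    nonneg     : ∀ {A} (a : Borel A) → 0ℝ ≤ measure a
    total      : (u : Borel U) → measure u ≃ 1ℝ
    σ-additive : ∀ {A : ℕ → Pred (Config q) 0ℓ} (a : ∀ n → Borel (A n)) (b : Borel (⋃ ℕ A)) →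
                 (∀ m n → m ≢ n → A m ⊥ A n) →
                 (λ n → sum (List.applyUpTo (λ k → measure (a k)) n)) ⟶ measure b
open ProbabilityMeasure public

Measurable : ∀ {q} → (Config q → Config q) → Set₁
Measurable f = ∀ {A} → Borel A → Borel (f ⊢ A)

pushforward : ∀ {q} (f : Config q → Config q) → Measurable f →
              ProbabilityMeasure q → ProbabilityMeasure q
pushforward f f-meas μ = record
  { measure    = λ a → measure μ (f-meas a)
  ; ext        = λ a b (A⊆B , B⊆A) → ext μ (f-meas a) (f-meas b) (A⊆B , B⊆A)
  ; nonneg     = λ a → nonneg μ (f-meas a)
  ; total      = λ u → total μ (f-meas u)
  ; σ-additive = λ a b dis →
      σ-additive μ (λ n → f-meas (a n)) (f-meas b) (λ m n m≢n → dis m n m≢n)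
  }

record IsBernoulli {q} (μ : ProbabilityMeasure q) (p : Fin q → ℝ) : Set where
  field
    p-nonneg  : ∀ a → 0ℝ ≤ p a
    p-sum     : sum (List.map p (List.allFin q)) ≃ 1ℝ
    cylinders : ∀ u i → measure μ (cylinder u i) ≃
                  product (List.map (λ a → p a ^ length (List.filter (a Fin.≟_) u)) (List.allFin q))

Complete : ∀ {q} → (Fin q → ℝ) → Set
Complete p = ∀ a → 0ℝ < p a

module Measurability {q : ℕ} where

  univᴮ : Borel {q} U
  univᴮ = resp ((λ _ → tt) , (λ _ ())) (cylinder [] (+ 0))

  ∅ᴮ : Borel {q} ∅
  ∅ᴮ = resp ((λ f → f tt) , (λ ())) (∁ᴮ univᴮ)

  constᴮ : ∀ {P : Set} → Dec P → Borel {q} (λ _ → P)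
  constᴮ (yes p) = resp ((λ _ → p) , (λ _ → tt)) univᴮ
  constᴮ (no ¬p) = resp ((λ ()) , ¬p) ∅ᴮ

  ∪ᴮ : ∀ {A B} → Borel {q} A → Borel B → Borel (A ∪ B)
  ∪ᴮ {A} {B} a b = resp
    ( (λ { (zero , x) → inj₁ x ; (suc _ , x) → inj₂ x })
    , (λ { (inj₁ x) → 0 , x ; (inj₂ x) → 1 , x }))
    (⋃ᴮ {A = λ { zero → A ; (suc _) → B }} λ { zero → a ; (suc _) → b })

  ∩ᴮ : ∀ {A B} → Borel {q} A → Borel B → Borel (A ∩ B)
  ∩ᴮ {A} {B} a b = resp
    ( (λ f → f 0 , f 1)
    , (λ { (x , y) zero → x ; (x , y) (suc _) → y }))
    (⋂ᴮ {A = λ { zero → A ; (suc _) → B }} λ { zero → a ; (suc _) → b })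

  ⋃ᶠ : ∀ n {A : Fin n → Pred (Config q) 0ℓ} → (∀ k → Borel (A k)) → Borel (⋃ (Fin n) A)
  ⋃ᶠ zero    a = resp ((λ ()) , (λ ())) ∅ᴮ
  ⋃ᶠ (suc n) a = resp
    ( (λ { (inj₁ x) → Fin.zero , x ; (inj₂ (k , x)) → Fin.suc k , x })
    , (λ { (Fin.zero , x) → inj₁ x ; (Fin.suc k , x) → inj₂ (k , x) }))
    (∪ᴮ (a Fin.zero) (⋃ᶠ n (a ∘ Fin.suc)))

  ⋂ᶠ : ∀ n {A : Fin n → Pred (Config q) 0ℓ} → (∀ k → Borel (A k)) → Borel (⋂ (Fin n) A)
  ⋂ᶠ zero    a = resp ((λ _ ()) , (λ _ → tt)) univᴮ
  ⋂ᶠ (suc n) a = resp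
    ( (λ { (x , f) Fin.zero → x ; (x , f) (Fin.suc k) → f k })
    , (λ f → f Fin.zero , f ∘ Fin.suc))
    (∩ᴮ (a Fin.zero) (⋂ᶠ n (a ∘ Fin.suc)))

  letterᴮ : ∀ j a → Borel {q} (λ c → c j ≡ a)
  letterᴮ j a = resp
    ( (λ {c} f → trans (cong c (sym (ℤP.+-identityʳ j))) (f Fin.zero))
    , (λ { {c} e Fin.zero → trans (cong c (ℤP.+-identityʳ j)) e }))
    (cylinder (a ∷ []) j)

  localᴮ : ∀ m (pos : Fin m → ℤ) {P : Vec (Fin q) m → Set} → (∀ v → Dec (P v)) →
           Borel (λ c → P (Vec.tabulate (c ∘ pos)))
  localᴮ zero    pos     P? = constᴮ (P? Vec.[])
  localᴮ (suc m) pos {P} P? = resp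
    ( (λ { {c} (a , refl , x) → x })
    , (λ {c} x → c (pos Fin.zero) , refl , x))
    (⋃ᶠ q λ a → ∩ᴮ (letterᴮ (pos Fin.zero) a)
      (localᴮ m (pos ∘ Fin.suc) {λ v → P (a Vec.∷ v)} (λ v → P? (a Vec.∷ v))))

  step-measurable : ∀ 𝓐 → Measurable (step {q} 𝓐)
  step-measurable 𝓐 (cylinder u i) = ⋂ᶠ (length u) λ k →
    localᴮ _ _ (λ v → rule 𝓐 v Fin.≟ lookup u k)
  step-measurable 𝓐 (∁ᴮ a)             = ∁ᴮ (step-measurable 𝓐 a)
  step-measurable 𝓐 (⋃ᴮ a)             = ⋃ᴮ λ n → step-measurable 𝓐 (a n)
  step-measurable 𝓐 (⋂ᴮ a)             = ⋂ᴮ λ n → step-measurable 𝓐 (a n)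
  step-measurable 𝓐 (resp (f , g) a)   = resp (f , g) (step-measurable 𝓐 a)

  steps-measurable : ∀ 𝓐 n → Measurable (steps {q} 𝓐 n)
  steps-measurable 𝓐 zero    a = a
  steps-measurable 𝓐 (suc n) a = steps-measurable 𝓐 n (step-measurable 𝓐 a)

_^_⟪_⟫ : ∀ {q} → CellularAutomaton q → ℕ → ProbabilityMeasure q → ProbabilityMeasure q
𝓐 ^ n ⟪ μ ⟫ = pushforward (steps 𝓐 n) (Measurability.steps-measurable 𝓐 n) μ

Vanishing : ∀ {q} → CellularAutomaton q → ProbabilityMeasure q → Word q → Set
Vanishing 𝓐 μ u = (λ n → measure (𝓐 ^ n ⟪ μ ⟫) (cylinder u (+ 0))) ⟶ 0ℝ

Persistent : ∀ {q} → CellularAutomaton q → ProbabilityMeasure q → Word q → Set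
Persistent 𝓐 μ u = ¬ Vanishing 𝓐 μ u

-- The start is -|u|/2 for |u| even and -(|u|+1)/2 for |u| odd.
⟨_⟩ : ∀ {q} → Word q → Pred (Config q) 0ℓ
⟨ u ⟩ = [ u ]at (ℤ.- + ⌈ length u /2⌉)

record IsWall {q} (𝓐 : CellularAutomaton q) (w : ℕ → Word q) : Set where
  field
    nonempty      : ∀ n → w n ≢ []
    propagates    : ∀ c → c ∈ ⟨ w 0 ⟩ → ∀ n → 1 ℕ.≤ n → steps 𝓐 n c ∈ ⟨ w n ⟩
    nonincreasing : ∀ m n → m ℕ.≤ n → length (w n) ℕ.≤ length (w m)

IsBrickOf : ∀ {q} → Word q → (ℕ → Word q) → Set
IsBrickOf u w = ∃[ p ] ∃[ n₀ ] (1 ℕ.≤ p × (∀ n → w (p ℕ.* n ℕ.+ n₀) ≡ u))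

IsBrick : ∀ {q} → CellularAutomaton q → Word q → Set
IsBrick 𝓐 u = ∃[ w ] (IsWall 𝓐 w × IsBrickOf u w)

{-# OPTIONS --safe #-}
module Submission where

-- If 𝓐 is not sensitive, some word w fixes the orbit of the r cells on either side of its centre
-- for all time.  An occurrence of w on each side of [0 , |u|) shields that interval from the
-- outside, so its orbit equals that of a spatially periodic configuration, which is periodic in
-- time from step q ^ P on, where P is its spatial period.  Hence if u still appears at 0
-- after that step, then it recurs and the shielding window is the foot of a wall with brick u.
-- So when u is not a brick, u can appear only if w is missing from the K aligned blocks to the
-- left or to the right of [0 , |u|), which has probability at most 2 (1 - μ(w))^K.
--
-- Conversely the foot of a wall has positive measure, and a translate of it lies in 𝓐⁻ⁿ [ u ]₀
-- for infinitely many n.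

open import Axiom.ExcludedMiddle using (ExcludedMiddle)
open import Data.Empty using (⊥-elim)
open import Data.Fin as Fin using (Fin; toℕ)
import Data.Fin.Properties as FinP
open import Data.Integer as ℤ using (ℤ; +_; -[1+_])
open import Data.Integer.DivMod using (_%ℕ_; _/ℕ_; n%ℕd<d; a≡a%ℕn+[a/ℕn]*n)
import Data.Integer.Properties as ℤP
import Data.Integer.Solver as ℤSolver
open import Data.List as List
  using (List; []; _∷_; _++_; length; lookup; cartesianProductWith; filter; allFin)
import Data.List.Membership.Propositional as Membership
open import Data.List.Membership.Propositional.Properties
  using (∈-allFin; ∈-cartesianProductWith⁺; ∈-filter⁺)
import Data.List.Properties as ListP
open import Data.List.Relation.Unary.All as All using (All; []; _∷_)
open import Data.List.Relation.Unary.AllPairs using ([]; _∷_)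
open import Data.List.Relation.Unary.Any using (Any; here; there; tail)
import Data.List.Relation.Unary.Any.Properties as AnyP
open import Data.List.Relation.Unary.Unique.Propositional using (Unique)
open import Data.List.Relation.Unary.Unique.Propositional.Properties using (allFin⁺)
open import Data.Nat as ℕ using (ℕ; zero; suc; ⌈_/2⌉; z≤n; s≤s)
open import Data.Nat.DivMod using (m<n⇒m%n≡m)
import Data.Nat.Properties as ℕP
open import Data.Product using (∃-syntax; _×_; _,_; proj₁; proj₂)
open import Data.Rational as ℚ using (ℚ; 0ℚ; 1ℚ; ½; ∣_∣)
import Data.Rational.Properties as ℚP
open import Data.Rational.Solver using (module +-*-Solver)
open import Data.Sum using (_⊎_; inj₁; inj₂; [_,_]′)
import Data.Vec.Properties as VecP
open import Defs
open import Function using (_∘_; _⇔_; mk⇔)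
open import Level using (0ℓ)
open import Relation.Binary.PropositionalEquality
  using (_≡_; _≢_; _≗_; refl; sym; trans; cong; cong₂; subst; subst₂)
open import Relation.Nullary using (¬_; Dec; yes; no; contradiction; ¬?)
open import Relation.Nullary.Decidable using (toSum; dec-true; decidable-stable)
open import Relation.Unary using (Pred; _∈_; _⊆_; _≐_; ∁; ⋃; _∩_; ∅; _⊥_)

open CauchyLemmas using (half-pos; halves; d-sym)
open DistanceLemmas using (½^>0; ½^-anti; ½^-small; diff≤; ι; 0≤ι; archimedean)

-- Eventual properties of sequences

-- The time q ^ P depends only on the length of the shielding window, not on what the window
-- contains. So K can be fixed from ε alone, and one bound then holds at every later time. The
-- blocks are disjoint, hence independent under μ, which gives the geometric decay. Real numbers are
-- Cauchy sequences, so all estimates are made on their rational terms. At a given index the letter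
-- weights sum to 1 only approximately, and the error is amplified along words of length |w|; half
-- of the weight of w is spent on absorbing it. Completeness and the finiteness of the alphabet give
-- one positive lower bound for all letters at all late indices, which keeps the rate of decay
-- independent of the index.

Eventually : (ℕ → Set) → Set
Eventually P = ∃[ N ] (∀ n → N ℕ.≤ n → P n)

eventually-map : ∀ {P Q : ℕ → Set} → (∀ n → P n → Q n) → Eventually P → Eventually Q
eventually-map f (N , h) = N , λ n N≤n → f n (h n N≤n)

eventually-map₂ : ∀ {P Q R : ℕ → Set} → (∀ n → P n → Q n → R n) →
                  Eventually P → Eventually Q → Eventually R
eventually-map₂ f (N , h) (M , k) = N ℕ.⊔ M , λ n p →
  f n (h n (ℕP.m⊔n≤o⇒m≤o N M p)) (k n (ℕP.m⊔n≤o⇒n≤o N M p))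

eventually-exists : ∀ {P : Set} → Eventually (λ _ → P) → P
eventually-exists (N , h) = h N ℕP.≤-refl

-- Order on real numbers

p≤∣p∣ : ∀ p → p ℚ.≤ ∣ p ∣
p≤∣p∣ p with ℚP.≤-total 0ℚ p
... | inj₁ 0≤p = ℚP.≤-reflexive (sym (ℚP.0≤p⇒∣p∣≡p 0≤p))
... | inj₂ p≤0 = ℚP.≤-trans p≤0 (ℚP.0≤∣p∣ p)

∣p∣<q : ∀ {p q} → p ℚ.< q → ℚ.- p ℚ.< q → ∣ p ∣ ℚ.< q
∣p∣<q {p} {q} p<q -p<q =
  [ (λ e → subst (ℚ._< q) (sym e) p<q) , (λ e → subst (ℚ._< q) (sym e) -p<q) ]′ (ℚP.∣p∣≡p∨∣p∣≡-p p)

p-q+q≡p : ∀ p q → (p ℚ.- q) ℚ.+ q ≡ p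
p-q+q≡p = +-*-Solver.solve 2 (λ x y → (x :- y) :+ y := x) refl
  where open +-*-Solver

p+q-q≡p : ∀ p q → (p ℚ.+ q) ℚ.- q ≡ p
p+q-q≡p = +-*-Solver.solve 2 (λ x y → (x :+ y) :- y := x) refl
  where open +-*-Solver

∣p-q∣<r⇒p<q+r : ∀ {p q r} → ∣ p ℚ.- q ∣ ℚ.< r → p ℚ.< q ℚ.+ r
∣p-q∣<r⇒p<q+r {p} {q} {r} h = subst₂ ℚ._<_ (p-q+q≡p p q) (ℚP.+-comm r q)
  (ℚP.+-monoˡ-< q (ℚP.≤-<-trans (p≤∣p∣ (p ℚ.- q)) h))

infix 4 _≼_ _≈_
infixl 6 _⊕_

_⊕_ : (ℕ → ℚ) → (ℕ → ℚ) → ℕ → ℚ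
(s ⊕ t) n = s n ℚ.+ t n

-- Asymptotic order of the sequences representing real numbers.  Real numbers are compared
-- through their sequences to keep Cauchy proofs out of the types.
record _≼_ (s t : ℕ → ℚ) : Set where
  constructor mk≼
  field
    below : ∀ ε → 0ℚ ℚ.< ε → Eventually λ n → s n ℚ.< t n ℚ.+ ε
open _≼_

_≈_ : (ℕ → ℚ) → (ℕ → ℚ) → Set
s ≈ t = s ≼ t × t ≼ s

0ˢ : ℕ → ℚ
0ˢ _ = 0ℚ

halve-< : ∀ a b c ε → a ℚ.< b ℚ.+ ½ ℚ.* ε → b ℚ.< c ℚ.+ ½ ℚ.* ε → a ℚ.< c ℚ.+ ε
halve-< a b c ε p q = ℚP.<-trans p (subst (b ℚ.+ ½ ℚ.* ε ℚ.<_)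
    (trans (ℚP.+-assoc c _ _) (cong (c ℚ.+_) (halves ε)))
    (ℚP.+-monoˡ-< (½ ℚ.* ε) q))

≼-trans : ∀ {s t u} → s ≼ t → t ≼ u → s ≼ u
≼-trans {s} {t} {u} s≼t t≼u = mk≼ λ ε 0<ε →
  eventually-map₂ (λ n → halve-< (s n) (t n) (u n) ε)
    (below s≼t (½ ℚ.* ε) (half-pos 0<ε)) (below t≼u (½ ℚ.* ε) (half-pos 0<ε))

⊕-mono-≼ : ∀ {s t u v} → s ≼ t → u ≼ v → s ⊕ u ≼ t ⊕ v
⊕-mono-≼ {s} {t} {u} {v} s≼t u≼v = mk≼ λ ε 0<ε →
  eventually-map₂
   (λ n p q → subst (s n ℚ.+ u n ℚ.<_)
      (trans (lem (t n) (½ ℚ.* ε) (v n)) (cong (t n ℚ.+ v n ℚ.+_) (halves ε)))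
      (ℚP.+-mono-< p q))
    (below s≼t (½ ℚ.* ε) (half-pos 0<ε)) (below u≼v (½ ℚ.* ε) (half-pos 0<ε))
  where
  lem : ∀ a h b → (a ℚ.+ h) ℚ.+ (b ℚ.+ h) ≡ (a ℚ.+ b) ℚ.+ (h ℚ.+ h)
  lem = +-*-Solver.solve 3 (λ a h b → (a :+ h) :+ (b :+ h) := (a :+ b) :+ (h :+ h)) refl
    where open +-*-Solver

≗⇒≼ : ∀ {s t} → s ≗ t → s ≼ t
≗⇒≼ {s} {t} e = mk≼ λ ε 0<ε → 0 , λ n _ →
  subst₂ ℚ._<_ (trans (ℚP.+-identityʳ (t n)) (sym (e n))) refl (ℚP.+-monoʳ-< (t n) 0<ε)

≼-refl : ∀ {s} → s ≼ s
≼-refl = ≗⇒≼ λ _ → refl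

-- As `x ≤ y` is a negation, a refutation is constructed: one late index with a gap of ε leaves, by
-- the Cauchy property with tolerance ε / 4, a gap of ε / 2 at all later indices, which is `y < x`.
≤⇒≼ : ∀ {x y} → x ≤ y → seq x ≼ seq y
≤⇒≼ {x} {y} ¬y<x = mk≼ compare
  where
  compare : ∀ ε → 0ℚ ℚ.< ε → Eventually λ n → seq x n ℚ.< seq y n ℚ.+ ε
  compare ε 0<ε = N ℕ.⊔ M , λ n p → ℚP.≰⇒> λ y+ε≤x →
    ¬y<x (h , half-pos 0<ε , N ℕ.⊔ M , λ m q → gap {seq x n} {seq x m} {seq y n} {seq y m}
      (∣p-q∣<r⇒p<q+r (f n m (ℕP.m⊔n≤o⇒m≤o N M p) (ℕP.m⊔n≤o⇒m≤o N M q)))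
      (∣p-q∣<r⇒p<q+r (g m n (ℕP.m⊔n≤o⇒n≤o N M q) (ℕP.m⊔n≤o⇒n≤o N M p)))
      y+ε≤x)
    where
    h   = ½ ℚ.* ε
    η   = ½ ℚ.* h
    0<η = half-pos (half-pos 0<ε)
    N   = proj₁ (cauchy x η 0<η)
    f   = proj₂ (cauchy x η 0<η)
    M   = proj₁ (cauchy y η 0<η)
    g   = proj₂ (cauchy y η 0<η)
    h+2η≡ε : h ℚ.+ (η ℚ.+ η) ≡ ε
    h+2η≡ε = trans (cong (h ℚ.+_) (halves h)) (halves ε)
    reduce : ∀ a → a ℚ.+ ε ℚ.- η ≡ a ℚ.+ η ℚ.+ h
    reduce a = trans (cong (λ z → a ℚ.+ z ℚ.- η) (sym h+2η≡ε)) (lem a h η)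
      where
      lem : ∀ a h u → a ℚ.+ (h ℚ.+ (u ℚ.+ u)) ℚ.- u ≡ a ℚ.+ u ℚ.+ h
      lem = +-*-Solver.solve 3 (λ a h u → a :+ (h :+ (u :+ u)) :- u := a :+ u :+ h) refl
        where open +-*-Solver
    gap : ∀ {xn xm yn ym} → xn ℚ.< xm ℚ.+ η → ym ℚ.< yn ℚ.+ η → yn ℚ.+ ε ℚ.≤ xn →
          ym ℚ.+ h ℚ.< xm
    gap {xn} {xm} {yn} {ym} a b c = ℚP.<-trans (ℚP.+-monoˡ-< h b)
      (subst₂ ℚ._<_ (reduce yn) (p+q-q≡p xm η)
        (ℚP.+-monoˡ-< (ℚ.- η) (ℚP.≤-<-trans c a)))

≃⇒≈ : ∀ {x y} → x ≃ y → seq x ≈ seq y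
≃⇒≈ {x} {y} x≃y =
    mk≼ (λ ε 0<ε → eventually-map (λ n → ∣p-q∣<r⇒p<q+r) (x≃y ε 0<ε))
  , mk≼ (λ ε 0<ε → eventually-map
      (λ n p → ∣p-q∣<r⇒p<q+r (subst (ℚ._< ε) (d-sym (seq x n) (seq y n)) p)) (x≃y ε 0<ε))

≈-refl : ∀ {s} → s ≈ s
≈-refl = ≼-refl , ≼-refl

≈-trans : ∀ {s t u} → s ≈ t → t ≈ u → s ≈ u
≈-trans (a , a′) (b , b′) = ≼-trans a b , ≼-trans b′ a′

⊕-cong-≈ : ∀ {s t u v} → s ≈ t → u ≈ v → s ⊕ u ≈ t ⊕ v
⊕-cong-≈ (a , a′) (b , b′) = ⊕-mono-≼ a b , ⊕-mono-≼ a′ b′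

⊕-identityʳ-≈ : ∀ {s} → s ⊕ 0ˢ ≈ s
⊕-identityʳ-≈ {s} = ≗⇒≼ (λ n → ℚP.+-identityʳ (s n)) , ≗⇒≼ (λ n → sym (ℚP.+-identityʳ (s n)))

-- Convergence

-- k runs along the sequence of reals and n along the rational terms of each. The threshold for n
-- may depend on k, so the two limits stay nested.
⟶⇒≈ε : ∀ {s x} → s ⟶ x → ∀ ε → 0ℚ ℚ.< ε → Eventually λ k →
       Eventually λ n → seq (s k) n ℚ.< seq x n ℚ.+ ε × seq x n ℚ.< seq (s k) n ℚ.+ ε
⟶⇒≈ε {s} {x} s⟶x ε 0<ε = eventually-map close (s⟶x (fromℚ ε) (½ ℚ.* ε , half-pos 0<ε , 0 , λ _ _ → 0+½ε<ε))
  where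
  0+½ε<ε : 0ℚ ℚ.+ ½ ℚ.* ε ℚ.< ε
  0+½ε<ε = subst (0ℚ ℚ.+ ½ ℚ.* ε ℚ.<_) (halves ε) (ℚP.+-monoˡ-< (½ ℚ.* ε) (half-pos 0<ε))
  close : ∀ k → abs (s k - x) < fromℚ ε →
          Eventually λ n → seq (s k) n ℚ.< seq x n ℚ.+ ε × seq x n ℚ.< seq (s k) n ℚ.+ ε
  close k (δ , 0<δ , ev) = eventually-map both ev
    where
    both : ∀ n → ∣ seq (s k) n ℚ.- seq x n ∣ ℚ.+ δ ℚ.< ε →
           seq (s k) n ℚ.< seq x n ℚ.+ ε × seq x n ℚ.< seq (s k) n ℚ.+ ε
    both n p = ∣p-q∣<r⇒p<q+r q , ∣p-q∣<r⇒p<q+r (subst (ℚ._< ε) (d-sym (seq (s k) n) (seq x n)) q)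
      where
      q : ∣ seq (s k) n ℚ.- seq x n ∣ ℚ.< ε
      q = ℚP.<-trans (subst (ℚ._< ∣ seq (s k) n ℚ.- seq x n ∣ ℚ.+ δ)
            (ℚP.+-identityʳ ∣ seq (s k) n ℚ.- seq x n ∣) (ℚP.+-monoʳ-< ∣ seq (s k) n ℚ.- seq x n ∣ 0<δ)) p

⟶-unique : ∀ {s x t} → s ⟶ x → Eventually (λ k → seq (s k) ≈ t) → seq x ≈ t
⟶-unique {s} {x} {t} s⟶x s≈t =
    mk≼ (λ ε 0<ε → eventually-exists (eventually-map₂
      (λ k p q → eventually-map₂ (λ n (_ , a) b → halve-< (seq x n) (seq (s k) n) (t n) ε a b)
        p (below (proj₁ q) (½ ℚ.* ε) (half-pos 0<ε)))
      (⟶⇒≈ε {s} {x} s⟶x (½ ℚ.* ε) (half-pos 0<ε)) s≈t))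
  , mk≼ (λ ε 0<ε → eventually-exists (eventually-map₂
      (λ k p q → eventually-map₂ (λ n (a , _) b → halve-< (t n) (seq (s k) n) (seq x n) ε b a)
        p (below (proj₂ q) (½ ℚ.* ε) (half-pos 0<ε)))
      (⟶⇒≈ε {s} {x} s⟶x (½ ℚ.* ε) (half-pos 0<ε)) s≈t))

-- Finite subadditivity

module MeasureProperties {q} (em : ExcludedMiddle 0ℓ) (μ : ProbabilityMeasure q) where

  open Measurability {q} using (∅ᴮ; ∩ᴮ)

  ∣_∣ᵐ : ∀ {A} → Borel A → ℕ → ℚ
  ∣ a ∣ᵐ = seq (measure μ a)

  ext-≈ : ∀ {A B} (a : Borel A) (b : Borel B) → A ≐ B → ∣ a ∣ᵐ ≈ ∣ b ∣ᵐ
  ext-≈ a b A≐B = ≃⇒≈ {measure μ a} {measure μ b} (ext μ a b A≐B)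

  0≼measure : ∀ {A} (a : Borel A) → 0ˢ ≼ ∣ a ∣ᵐ
  0≼measure a = ≤⇒≼ {0ℝ} {measure μ a} (nonneg μ a)

  -- The partial sums of Σ μ(∅) are arithmetic progressions with difference μ(∅).
  measure-∅ : ∣ ∅ᴮ ∣ᵐ ≈ 0ˢ
  measure-∅ = mk≼ small , 0≼measure ∅ᴮ
    where
    e x : ℝ
    e = measure μ ∅ᴮ
    x = measure μ (⋃ᴮ λ _ → ∅ᴮ)
    s : ℕ → ℝ
    s n = sum (List.applyUpTo (λ _ → e) n)
    limit = ⟶⇒≈ε {s} {x} (σ-additive μ (λ _ → ∅ᴮ) (⋃ᴮ λ _ → ∅ᴮ) (λ { _ _ _ (() , _) }))
    cancel : ∀ e s x → e ℚ.+ s ℚ.+ x ℚ.+ (ℚ.- s ℚ.- x) ≡ e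
    cancel = +-*-Solver.solve 3 (λ e s x → e :+ s :+ x :+ (:- s :- x) := e) refl
      where open +-*-Solver
    cancel′ : ∀ s x h → x ℚ.+ h ℚ.+ (s ℚ.+ h) ℚ.+ (ℚ.- s ℚ.- x) ≡ 0ℚ ℚ.+ (h ℚ.+ h)
    cancel′ = +-*-Solver.solve 3 (λ s x h → x :+ h :+ (s :+ h) :+ (:- s :- x) := con 0ℚ :+ (h :+ h)) refl
      where open +-*-Solver
    subtract : ∀ {e s x h} → e ℚ.+ s ℚ.< x ℚ.+ h → x ℚ.< s ℚ.+ h → e ℚ.< 0ℚ ℚ.+ (h ℚ.+ h)
    subtract {e} {s} {x} {h} p q = subst₂ ℚ._<_ (cancel e s x) (cancel′ s x h)
      (ℚP.+-monoˡ-< (ℚ.- s ℚ.- x) (ℚP.+-mono-< p q))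
    small : ∀ ε → 0ℚ ℚ.< ε → Eventually λ n → seq e n ℚ.< 0ℚ ℚ.+ ε
    small ε 0<ε = eventually-map₂ {P = close N} {Q = close (suc N)}
      (λ n (_ , a) (b , _) → subst (λ z → seq e n ℚ.< 0ℚ ℚ.+ z) (halves ε)
        (subtract {seq e n} {seq (s N) n} {seq x n} {½ ℚ.* ε} b a))
      (h N ℕP.≤-refl) (h (suc N) (ℕP.n≤1+n N))
      where
      close : ℕ → ℕ → Set
      close k n = seq (s k) n ℚ.< seq x n ℚ.+ ½ ℚ.* ε × seq x n ℚ.< seq (s k) n ℚ.+ ½ ℚ.* ε
      tail-close : Eventually λ k → Eventually (close k)
      tail-close = limit (½ ℚ.* ε) (half-pos 0<ε)
      N = proj₁ tail-close
      h = proj₂ tail-close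

  -- Finite additivity from σ-additivity: the family is padded with ∅, which has measure 0. Excluded
  -- middle makes A and its complement cover C.
  measure-split : ∀ {A C} (c : Borel C) (a : Borel A) →
                  ∣ c ∣ᵐ ≈ ∣ ∩ᴮ c a ∣ᵐ ⊕ ∣ ∩ᴮ c (∁ᴮ a) ∣ᵐ
  measure-split {A} {C} c a = ≈-trans (ext-≈ c (⋃ᴮ parts) C≐⋃P)
    (⟶-unique {s} {measure μ (⋃ᴮ parts)} (σ-additive μ parts (⋃ᴮ parts) disjoint) (2 , partial))
    where
    P : ℕ → Pred (Config q) 0ℓ
    P 0             = C ∩ A
    P 1             = C ∩ ∁ A
    P (suc (suc _)) = ∅
    parts : ∀ n → Borel (P n)
    parts 0             = ∩ᴮ c a
    parts 1             = ∩ᴮ c (∁ᴮ a)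
    parts (suc (suc _)) = ∅ᴮ
    disjoint : ∀ m n → m ≢ n → P m ⊥ P n
    disjoint 0 0 0≢0 _ = 0≢0 refl
    disjoint 1 1 1≢1 _ = 1≢1 refl
    disjoint 0 1 _ ((_ , x∈A) , (_ , x∉A)) = x∉A x∈A
    disjoint 1 0 _ ((_ , x∉A) , (_ , x∈A)) = x∉A x∈A
    disjoint (suc (suc _)) _ _ (() , _)
    disjoint 0 (suc (suc _)) _ (_ , ())
    disjoint 1 (suc (suc _)) _ (_ , ())
    C≐⋃P : C ≐ ⋃ ℕ P
    C≐⋃P = (λ {x} x∈C → [ (λ x∈A → 0 , x∈C , x∈A) , (λ x∉A → 1 , x∈C , x∉A) ]′ (toSum (em {x ∈ A})))
         , λ { (0 , x∈C , _) → x∈C ; (1 , x∈C , _) → x∈C }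
    s t : ℕ → ℝ
    s n = sum (List.applyUpTo (λ k → measure μ (parts k)) n)
    t n = sum (List.applyUpTo (λ _ → measure μ ∅ᴮ) n)
    zeros : ∀ n → seq (t n) ≈ 0ˢ
    zeros zero    = ≈-refl
    zeros (suc n) = ≈-trans (⊕-cong-≈ measure-∅ (zeros n)) ⊕-identityʳ-≈
    partial : ∀ n → 2 ℕ.≤ n → seq (s n) ≈ ∣ ∩ᴮ c a ∣ᵐ ⊕ ∣ ∩ᴮ c (∁ᴮ a) ∣ᵐ
    partial (suc (suc n)) (ℕ.s≤s (ℕ.s≤s _)) =
      ⊕-cong-≈ (≈-refl {∣ ∩ᴮ c a ∣ᵐ}) (≈-trans (⊕-cong-≈ (≈-refl {∣ ∩ᴮ c (∁ᴮ a) ∣ᵐ}) (zeros n)) ⊕-identityʳ-≈)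

  measure-mono : ∀ {A B} (a : Borel A) (b : Borel B) → A ⊆ B → ∣ a ∣ᵐ ≼ ∣ b ∣ᵐ
  measure-mono {A} {B} a b A⊆B =
    ≼-trans (proj₁ (ext-≈ a (∩ᴮ b a) ((λ x∈A → A⊆B x∈A , x∈A) , proj₂)))
    (≼-trans (proj₂ ⊕-identityʳ-≈)
    (≼-trans (⊕-mono-≼ (≼-refl {∣ ∩ᴮ b a ∣ᵐ}) (0≼measure (∩ᴮ b (∁ᴮ a))))
    (proj₂ (measure-split b a))))

  -- Union bound without disjointness: splitting A along the first cylinder leaves a remainder
  -- outside it, and this remainder is covered by the tail of the list.
  measure-cover : ∀ (L : List (Word q × ℤ)) {A} (a : Borel A) →
    (∀ c → c ∈ A → Any (λ (v , j) → c ∈ [ v ]at j) L) →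
    ∣ a ∣ᵐ ≼ seq (sum (List.map (λ (v , j) → measure μ (cylinder v j)) L))
  measure-cover []            a cov =
    ≼-trans (proj₁ (ext-≈ a ∅ᴮ ((λ {c} c∈A → AnyP.¬Any[] (cov c c∈A)) , λ ()))) (proj₁ measure-∅)
  measure-cover ((v , j) ∷ L) {A} a cov =
    ≼-trans (proj₁ (measure-split a (cylinder v j)))
      (⊕-mono-≼ (measure-mono (∩ᴮ a (cylinder v j)) (cylinder v j) proj₂)
        (measure-cover L (∩ᴮ a (∁ᴮ (cylinder v j)))
          λ c (c∈A , c∉v) → tail c∉v (cov c c∈A)))

-- Words read off configurations

read : ∀ {q} → Config q → ℤ → ℕ → Word q
read c i n = List.tabulate {n = n} λ k → c (i ℤ.+ + toℕ k)

length-read : ∀ {q} (c : Config q) i n → length (read c i n) ≡ n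
length-read c i n = ListP.length-tabulate {n = n} (λ k → c (i ℤ.+ + toℕ k))

lookup-tabulate-cast : ∀ {A : Set} {n} (f : Fin n → A) (k : Fin (length (List.tabulate f))) →
                       f (Fin.cast (ListP.length-tabulate f) k) ≡ lookup (List.tabulate f) k
lookup-tabulate-cast {n = suc n} f Fin.zero    = refl
lookup-tabulate-cast {n = suc n} f (Fin.suc k) = lookup-tabulate-cast (f ∘ Fin.suc) k

∈-read : ∀ {q} (c : Config q) i n → c ∈ [ read c i n ]at i
∈-read c i n k = trans
  (cong (λ t → c (i ℤ.+ + t)) (sym (FinP.toℕ-cast (length-read c i n) k)))
  (lookup-tabulate-cast {n = n} (λ k → c (i ℤ.+ + toℕ k)) k)

read-∈ : ∀ {q} (c : Config q) u i → c ∈ [ u ]at i → read c i (length u) ≡ u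
read-∈ c u i c∈ = trans (ListP.tabulate-cong c∈) (ListP.tabulate-lookup u)

cylinder-transfer : ∀ {q} (c c′ : Config q) u i i′ → c ∈ [ u ]at i →
  (∀ k → k ℕ.< length u → c′ (i′ ℤ.+ + k) ≡ c (i ℤ.+ + k)) → c′ ∈ [ u ]at i′
cylinder-transfer c c′ u i i′ c∈ e k = trans (e (toℕ k) (FinP.toℕ<n k)) (c∈ k)

cylinder-agree : ∀ {q} (c c′ : Config q) u i i′ → c ∈ [ u ]at i → c′ ∈ [ u ]at i′ →
  ∀ k → k ℕ.< length u → c (i ℤ.+ + k) ≡ c′ (i′ ℤ.+ + k)
cylinder-agree c c′ u i i′ c∈ c′∈ k k<u =
  subst (λ t → c (i ℤ.+ + t) ≡ c′ (i′ ℤ.+ + t)) (FinP.toℕ-fromℕ< k<u)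
    (trans (c∈ (Fin.fromℕ< k<u)) (sym (c′∈ (Fin.fromℕ< k<u))))

read-agree : ∀ {q} (c c′ : Config q) i i′ n → c′ ∈ [ read c i n ]at i′ →
  ∀ k → k ℕ.< n → c′ (i′ ℤ.+ + k) ≡ c (i ℤ.+ + k)
read-agree c c′ i i′ n c′∈ k k<n = cylinder-agree c′ c (read c i n) i′ i c′∈ (∈-read c i n) k
  (subst (k ℕ.<_) (sym (length-read c i n)) k<n)

-- Locality of cellular automata

module Dynamics {q} (𝓐 : CellularAutomaton q) where

  r : ℕ
  r = radius 𝓐

  -- Allowing two positions makes this serve both for locality and for commutation with shifts.
  step-local : ∀ c c′ i i′ →
    (∀ k → k ℕ.≤ 2 ℕ.* r → c (i ℤ.- + r ℤ.+ + k) ≡ c′ (i′ ℤ.- + r ℤ.+ + k)) →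
    step 𝓐 c i ≡ step 𝓐 c′ i′
  step-local c c′ i i′ e = cong (rule 𝓐) (VecP.tabulate-cong λ k →
    e (toℕ k) (ℕP.≤-pred (subst (toℕ k ℕ.<_) (ℕP.+-comm (2 ℕ.* r) 1) (FinP.toℕ<n k))))

  step-cong : ∀ c c′ → c ≗ c′ → step 𝓐 c ≗ step 𝓐 c′
  step-cong c c′ e i = step-local c c′ i i λ k _ → e _

  steps-shift : ∀ c c′ j → (∀ i → c′ i ≡ c (i ℤ.+ j)) →
                ∀ n i → steps 𝓐 n c′ i ≡ steps 𝓐 n c (i ℤ.+ j)
  steps-shift c c′ j e zero    i = e i
  steps-shift c c′ j e (suc n) i = step-local (steps 𝓐 n c′) (steps 𝓐 n c) i (i ℤ.+ j) λ k _ →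
    trans (steps-shift c c′ j e n (i ℤ.- + r ℤ.+ + k)) (cong (steps 𝓐 n c) (lem i (+ r) (+ k) j))
    where
    open ℤSolver.+-*-Solver
    lem : ∀ i r k j → i ℤ.- r ℤ.+ k ℤ.+ j ≡ i ℤ.+ j ℤ.- r ℤ.+ k
    lem = solve 4 (λ i r k j → i :- r :+ k :+ j := i :+ j :- r :+ k) refl

  -- m is the offset in w of the centre of the protected column, which has 2r + 1 cells. Comparing
  -- any two configurations containing w avoids naming the common orbit.
  Blocking : Word q → ℕ → Set
  Blocking w m = ∀ c c′ j → c ∈ [ w ]at j → c′ ∈ [ w ]at j →
    ∀ n i → ℤ.∣ i ∣ ℕ.≤ r → steps 𝓐 n c (i ℤ.+ (j ℤ.+ + m)) ≡ steps 𝓐 n c′ (i ℤ.+ (j ℤ.+ + m))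

  -- Information cannot cross a column of width at least r that is known at all times.
  agree-between : ∀ c c′ l T →
    (∀ n i → ℤ.∣ i ∣ ℕ.≤ r → steps 𝓐 n c (i ℤ.+ l) ≡ steps 𝓐 n c′ (i ℤ.+ l)) →
    (∀ n i → ℤ.∣ i ∣ ℕ.≤ r → steps 𝓐 n c (i ℤ.+ (l ℤ.+ + T)) ≡ steps 𝓐 n c′ (i ℤ.+ (l ℤ.+ + T))) →
    (∀ t → t ℕ.≤ T → c (l ℤ.+ + t) ≡ c′ (l ℤ.+ + t)) →
    ∀ n t → t ℕ.≤ T → steps 𝓐 n c (l ℤ.+ + t) ≡ steps 𝓐 n c′ (l ℤ.+ + t)
  agree-between c c′ l T left right init zero    t t≤T = init t t≤T
  agree-between c c′ l T left right init (suc n) t t≤T with t ℕP.≤? r | T ℕ.∸ t ℕP.≤? r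
  -- A cell within r of an end belongs to a known column. Farther inside, its whole neighbourhood
  -- lies in the interval, so induction on time applies.
  ... | yes t≤r | _ =
    subst (λ i → steps 𝓐 (suc n) c i ≡ steps 𝓐 (suc n) c′ i) (ℤP.+-comm (+ t) l) (left (suc n) (+ t) t≤r)
  ... | no _ | yes T∸t≤r =
    subst (λ i → steps 𝓐 (suc n) c i ≡ steps 𝓐 (suc n) c′ i) e
      (right (suc n) (ℤ.- + (T ℕ.∸ t)) (subst (ℕ._≤ r) (sym (ℤP.∣-i∣≡∣i∣ (+ (T ℕ.∸ t)))) T∸t≤r))
    where
    open ℤSolver.+-*-Solver
    e : ℤ.- + (T ℕ.∸ t) ℤ.+ (l ℤ.+ + T) ≡ l ℤ.+ + t
    e = trans (cong (λ T → ℤ.- + (T ℕ.∸ t) ℤ.+ (l ℤ.+ + T)) (sym (ℕP.m+[n∸m]≡n t≤T)))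
        (trans (cong (λ z → ℤ.- + z ℤ.+ (l ℤ.+ + (t ℕ.+ (T ℕ.∸ t)))) (ℕP.m+n∸m≡n t (T ℕ.∸ t)))
        (trans (cong (λ z → ℤ.- + (T ℕ.∸ t) ℤ.+ (l ℤ.+ z)) (ℤP.pos-+ t (T ℕ.∸ t)))
        (solve 3 (λ d l t → :- d :+ (l :+ (t :+ d)) := l :+ t) refl (+ (T ℕ.∸ t)) l (+ t))))
  ... | no t≰r | no T∸t≰r = step-local (steps 𝓐 n c) (steps 𝓐 n c′) (l ℤ.+ + t) (l ℤ.+ + t) λ k k≤2r →
    subst (λ i → steps 𝓐 n c i ≡ steps 𝓐 n c′ i) (sym (e k))
      (agree-between c c′ l T left right init n (t ℕ.∸ r ℕ.+ k) (bound k k≤2r))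
    where
    r≤t : r ℕ.≤ t
    r≤t = ℕP.<⇒≤ (ℕP.≰⇒> t≰r)
    e : ∀ k → l ℤ.+ + t ℤ.- + r ℤ.+ + k ≡ l ℤ.+ + (t ℕ.∸ r ℕ.+ k)
    e k = trans (lem l (+ t) (+ r) (+ k)) (cong (ℤ._+_ l)
      (trans (cong (ℤ._+ + k) (trans (ℤP.m-n≡m⊖n t r) (ℤP.⊖-≥ r≤t))) (sym (ℤP.pos-+ (t ℕ.∸ r) k))))
      where
      open ℤSolver.+-*-Solver
      lem : ∀ l t r k → l ℤ.+ t ℤ.- r ℤ.+ k ≡ l ℤ.+ ((t ℤ.- r) ℤ.+ k)
      lem = solve 4 (λ l t r k → l :+ t :- r :+ k := l :+ ((t :- r) :+ k)) refl
    bound : ∀ k → k ℕ.≤ 2 ℕ.* r → t ℕ.∸ r ℕ.+ k ℕ.≤ T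
    bound k k≤2r = begin
      t ℕ.∸ r ℕ.+ k                    ≤⟨ ℕP.+-monoʳ-≤ (t ℕ.∸ r) k≤2r ⟩
      t ℕ.∸ r ℕ.+ (r ℕ.+ (r ℕ.+ 0))    ≡⟨ cong (λ z → t ℕ.∸ r ℕ.+ (r ℕ.+ z)) (ℕP.+-identityʳ r) ⟩
      t ℕ.∸ r ℕ.+ (r ℕ.+ r)            ≡⟨ sym (ℕP.+-assoc (t ℕ.∸ r) r r) ⟩
      t ℕ.∸ r ℕ.+ r ℕ.+ r              ≡⟨ cong (ℕ._+ r) (ℕP.m∸n+n≡m r≤t) ⟩
      t ℕ.+ r                          ≤⟨ ℕP.+-monoʳ-≤ t (ℕP.<⇒≤ (ℕP.≰⇒> T∸t≰r)) ⟩
      t ℕ.+ (T ℕ.∸ t)                  ≡⟨ ℕP.m+[n∸m]≡n t≤T ⟩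
      T                                ∎
      where open ℕP.≤-Reasoning

-- Spatially periodic configurations

%ℕ-unique : ∀ P .{{_ : ℕ.NonZero P}} {a b} x y → a ℕ.< P → b ℕ.< P →
            + a ℤ.+ x ℤ.* + P ≡ + b ℤ.+ y ℤ.* + P → a ≡ b
%ℕ-unique P {a} {b} x y a<P b<P e = ℤP.+-injective (ℤP.i-j≡0⇒i≡j (+ a) (+ b)
    (trans a-b (trans (cong (ℤ._* + P) y-x≡0) (ℤP.*-zeroˡ (+ P)))))
  where
  open ℤSolver.+-*-Solver
  a-b : + a ℤ.- + b ≡ (y ℤ.- x) ℤ.* + P
  a-b = trans (solve 4 (λ a b x P → a :- b := (a :+ x :* P) :- (b :+ x :* P)) refl (+ a) (+ b) x (+ P))
        (trans (cong (ℤ._- (+ b ℤ.+ x ℤ.* + P)) e)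
        (solve 4 (λ b x y P → (b :+ y :* P) :- (b :+ x :* P) := (y :- x) :* P) refl (+ b) x y (+ P)))
  small : ℤ.∣ y ℤ.- x ∣ ℕ.* P ℕ.< 1 ℕ.* P
  small = subst₂ ℕ._<_
    (trans (cong ℤ.∣_∣ (trans (sym (ℤP.m-n≡m⊖n a b)) a-b)) (ℤP.∣i*j∣≡∣i∣*∣j∣ (y ℤ.- x) (+ P)))
    (sym (ℕP.*-identityˡ P))
    (ℕP.≤-<-trans (ℤP.∣m⊝n∣≤m⊔n a b) (ℕP.⊔-pres-<m a<P b<P))
  y-x≡0 : y ℤ.- x ≡ + 0
  y-x≡0 = ℤP.∣i∣≡0⇒i≡0 (ℕP.n<1⇒n≡0 (ℕP.*-cancelʳ-< P _ 1 small))

[i+jP]%ℕP≡i%ℕP : ∀ i j P .{{_ : ℕ.NonZero P}} → (i ℤ.+ j ℤ.* + P) %ℕ P ≡ i %ℕ P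
[i+jP]%ℕP≡i%ℕP i j P = %ℕ-unique P ((i ℤ.+ j ℤ.* + P) /ℕ P) (i /ℕ P ℤ.+ j)
  (n%ℕd<d (i ℤ.+ j ℤ.* + P) P) (n%ℕd<d i P)
  (trans (sym (a≡a%ℕn+[a/ℕn]*n (i ℤ.+ j ℤ.* + P) P))
  (trans (cong (ℤ._+ j ℤ.* + P) (a≡a%ℕn+[a/ℕn]*n i P))
  (solve 4 (λ a x j P → (a :+ x :* P) :+ j :* P := a :+ (x :+ j) :* P) refl (+ (i %ℕ P)) (i /ℕ P) j (+ P))))
  where open ℤSolver.+-*-Solver

periodize : ∀ {q} → Config q → ℤ → (P : ℕ) .{{_ : ℕ.NonZero P}} → Config q
periodize c a P i = c (a ℤ.+ + ((i ℤ.- a) %ℕ P))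

periodize-agree : ∀ {q} (c : Config q) a P .{{_ : ℕ.NonZero P}} k → k ℕ.< P →
                  periodize c a P (a ℤ.+ + k) ≡ c (a ℤ.+ + k)
periodize-agree c a P k k<P = cong (λ z → c (a ℤ.+ + z))
  (trans (cong (_%ℕ P) (solve 2 (λ a k → a :+ k :- a := k) refl a (+ k))) (m<n⇒m%n≡m k<P))
  where open ℤSolver.+-*-Solver

periodize-periodic : ∀ {q} (c : Config q) a P .{{_ : ℕ.NonZero P}} j i →
                     periodize c a P i ≡ periodize c a P (i ℤ.+ j ℤ.* + P)
periodize-periodic c a P j i = cong (λ z → c (a ℤ.+ + z)) (sym
  (trans (cong (_%ℕ P) (solve 3 (λ i x a → i :+ x :- a := i :- a :+ x) refl i (j ℤ.* + P) a))
    ([i+jP]%ℕP≡i%ℕP (i ℤ.- a) j P)))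
  where open ℤSolver.+-*-Solver

module Periodicity {q} (𝓐 : CellularAutomaton q) (c : Config q) (a : ℤ) (P : ℕ) .{{_ : ℕ.NonZero P}} where
  open Dynamics 𝓐

  c° : Config q
  c° = periodize c a P

  steps-periodic : ∀ n i → steps 𝓐 n c° i ≡ steps 𝓐 n c° (a ℤ.+ + ((i ℤ.- a) %ℕ P))
  steps-periodic n i = trans
    (steps-shift c° c° (ℤ.- x ℤ.* + P) (periodize-periodic c a P (ℤ.- x)) n i)
    (cong (steps 𝓐 n c°) (trans (cong (ℤ._+ ℤ.- x ℤ.* + P) decomposition)
      (solve 4 (λ a y x P → (a :+ (y :+ x :* P)) :+ :- x :* P := a :+ y) refl a (+ ((i ℤ.- a) %ℕ P)) x (+ P))))
    where
    open ℤSolver.+-*-Solver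
    x = (i ℤ.- a) /ℕ P
    decomposition : i ≡ a ℤ.+ (+ ((i ℤ.- a) %ℕ P) ℤ.+ x ℤ.* + P)
    decomposition = trans (solve 2 (λ i a → i := a :+ (i :- a)) refl i a)
      (cong (ℤ._+_ a) (a≡a%ℕn+[a/ℕn]*n (i ℤ.- a) P))

  window : ℕ → Fin P → Fin q
  window n k = steps 𝓐 n c° (a ℤ.+ + toℕ k)

  steps-determined : ∀ {m n} → window m ≗ window n → steps 𝓐 m c° ≗ steps 𝓐 n c°
  steps-determined {m} {n} e i = trans (steps-periodic m i) (trans
    (subst (λ z → steps 𝓐 m c° (a ℤ.+ + z) ≡ steps 𝓐 n c° (a ℤ.+ + z))
      (FinP.toℕ-fromℕ< (n%ℕd<d (i ℤ.- a) P)) (e (Fin.fromℕ< (n%ℕd<d (i ℤ.- a) P))))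
    (sym (steps-periodic n i)))

  steps-+ : ∀ {m n} → steps 𝓐 m c° ≗ steps 𝓐 n c° → ∀ k → steps 𝓐 (k ℕ.+ m) c° ≗ steps 𝓐 (k ℕ.+ n) c°
  steps-+ e zero    = e
  steps-+ {m} {n} e (suc k) = step-cong (steps 𝓐 (k ℕ.+ m) c°) (steps 𝓐 (k ℕ.+ n) c°) (steps-+ {m} {n} e k)

  -- Pigeonhole on the windows at times 0 to q ^ P, of which there are at most q ^ P different ones.
  -- The period p depends on c, but the first of the two equal windows occurs by time q ^ P whatever
  -- c is.
  eventually-periodic : ∃[ p ] (1 ℕ.≤ p × (∀ n → q ℕ.^ P ℕ.≤ n → ∀ k →
                          steps 𝓐 (p ℕ.* k ℕ.+ n) c° ≗ steps 𝓐 n c°))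
  eventually-periodic with FinP.pigeonhole (ℕP.n<1+n (q ℕ.^ P)) (λ k → Fin.funToFin (window (toℕ k)))
  ... | i , j , i<j , e = p , ℕP.m<n⇒0<n∸m i<j , periodic
    where
    p = toℕ j ℕ.∸ toℕ i
    window-≗ : window (toℕ i) ≗ window (toℕ j)
    window-≗ k = trans (sym (FinP.finToFun-funToFin (window (toℕ i)) k))
      (trans (cong (λ z → Fin.finToFun z k) e) (FinP.finToFun-funToFin (window (toℕ j)) k))
    once : ∀ n → toℕ i ℕ.≤ n → steps 𝓐 (p ℕ.+ n) c° ≗ steps 𝓐 n c°
    once n i≤n x = sym (subst₂ (λ y z → steps 𝓐 y c° x ≡ steps 𝓐 z c° x) (ℕP.m∸n+n≡m i≤n) e′
      (steps-+ {toℕ i} {toℕ j} (steps-determined {toℕ i} {toℕ j} window-≗) (n ℕ.∸ toℕ i) x))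
      where
      e′ : (n ℕ.∸ toℕ i) ℕ.+ toℕ j ≡ p ℕ.+ n
      e′ = trans (cong ((n ℕ.∸ toℕ i) ℕ.+_) (sym (ℕP.m+[n∸m]≡n (ℕP.<⇒≤ i<j))))
          (trans (sym (ℕP.+-assoc (n ℕ.∸ toℕ i) (toℕ i) p))
          (trans (cong (ℕ._+ p) (ℕP.m∸n+n≡m i≤n)) (ℕP.+-comm n p)))
    periodic : ∀ n → q ℕ.^ P ℕ.≤ n → ∀ k → steps 𝓐 (p ℕ.* k ℕ.+ n) c° ≗ steps 𝓐 n c°
    periodic n N≤n zero    x rewrite ℕP.*-zeroʳ p = refl
    periodic n N≤n (suc k) x rewrite ℕP.*-suc p k | ℕP.+-assoc p (p ℕ.* k) n =
      trans (once (p ℕ.* k ℕ.+ n) (ℕP.≤-trans (FinP.toℕ≤pred[n] i) (ℕP.≤-trans N≤n (ℕP.m≤n+m n (p ℕ.* k)))) x)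
        (periodic n N≤n k x)

-- Walls whose foot is a shielding window

⌈m+[n+m]/2⌉≡m+⌈n/2⌉ : ∀ m n → ⌈ m ℕ.+ (n ℕ.+ m) /2⌉ ≡ m ℕ.+ ⌈ n /2⌉
⌈m+[n+m]/2⌉≡m+⌈n/2⌉ zero    n = cong ⌈_/2⌉ (ℕP.+-identityʳ n)
⌈m+[n+m]/2⌉≡m+⌈n/2⌉ (suc m) n rewrite ℕP.+-suc n m | ℕP.+-suc m (n ℕ.+ m) =
  cong suc (⌈m+[n+m]/2⌉≡m+⌈n/2⌉ m n)

length>0 : ∀ {q} (u : Word q) → u ≢ [] → 0 ℕ.< length u
length>0 []      u≢[] = contradiction refl u≢[]
length>0 (_ ∷ _) _    = s≤s z≤n

-m+[n+k] : ∀ m n k → ℤ.- + m ℤ.+ + (n ℕ.+ k) ≡ ℤ.- + m ℤ.+ + n ℤ.+ + k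
-m+[n+k] m n k = trans (cong (ℤ._+_ (ℤ.- + m)) (ℤP.pos-+ n k)) (sym (ℤP.+-assoc (ℤ.- + m) (+ n) (+ k)))

-m+[m+k] : ∀ m k → ℤ.- + m ℤ.+ + (m ℕ.+ k) ≡ + k
-m+[m+k] m k = trans (-m+[n+k] m m k) (trans (cong (ℤ._+ + k) (ℤP.+-inverseˡ (+ m))) (ℤP.+-identityˡ (+ k)))

module Bricks {q} (𝓐 : CellularAutomaton q) (u : Word q) (u≢[] : u ≢ []) (Y : ℕ) where
  open Dynamics 𝓐

  P : ℕ
  P = Y ℕ.+ (length u ℕ.+ Y)

  -- c on [-Y , length u + Y) determines its orbit on [0 , length u).
  Determining : Config q → Set
  Determining c = ∀ c′ → (∀ k → k ℕ.< P → c′ (ℤ.- + Y ℤ.+ + k) ≡ c (ℤ.- + Y ℤ.+ + k)) →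
                  ∀ n k → k ℕ.< length u → steps 𝓐 n c′ (+ k) ≡ steps 𝓐 n c (+ k)

  0<P : 0 ℕ.< P
  0<P = ℕP.≤-trans (length>0 u u≢[]) (ℕP.≤-trans (ℕP.m≤m+n (length u) Y) (ℕP.m≤n+m _ Y))

  determining⇒brick : ∀ c → Determining c → ∀ n → q ℕ.^ P ℕ.< n →
                      steps 𝓐 n c ∈ [ u ]at (+ 0) → IsBrick 𝓐 u
  determining⇒brick c det n N<n c∈ = w , wall , proj₁ eventually-periodic , n
                                   , proj₁ (proj₂ eventually-periodic) , isBrick
    where
    instance
      P-nonZero : ℕ.NonZero P
      P-nonZero = ℕ.>-nonZero 0<P
    open Periodicity 𝓐 c (ℤ.- + Y) P
    c°-agree : ∀ k → k ℕ.< P → c° (ℤ.- + Y ℤ.+ + k) ≡ c (ℤ.- + Y ℤ.+ + k)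
    c°-agree = periodize-agree c (ℤ.- + Y) P
    det° : Determining c°
    det° c′ e n k k<u = trans (det c′ (λ k k<P → trans (e k k<P) (c°-agree k k<P)) n k k<u)
                              (sym (det c° c°-agree n k k<u))
    h = ⌈ length u /2⌉
    -- The words are read off the orbit of `c°`, because only that orbit is known to be periodic in
    -- time. The length drops once, from P to |u|, at time 1.
    w : ℕ → Word q
    w zero      = read c° (ℤ.- + Y) P
    w n@(suc _) = read (steps 𝓐 n c°) (+ 0) (length u)
    length-w : ∀ n → 1 ℕ.≤ n → length (w n) ≡ length u
    length-w n@(suc _) _ = length-read (steps 𝓐 n c°) (+ 0) (length u)
    length-w₀ : length (w 0) ≡ P
    length-w₀ = length-read c° (ℤ.- + Y) P
    u≤P : length u ℕ.≤ P
    u≤P = ℕP.≤-trans (ℕP.m≤m+n (length u) Y) (ℕP.m≤n+m _ Y)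
    propagates : ∀ c′ → c′ ∈ ⟨ w 0 ⟩ → ∀ n → 1 ℕ.≤ n → steps 𝓐 n c′ ∈ ⟨ w n ⟩
    propagates c′ c′∈ n@(suc _) 1≤n =
      cylinder-transfer (steps 𝓐 n c°) (steps 𝓐 n c′) (w n) (+ 0) (ℤ.- + ⌈ length (w n) /2⌉)
        (∈-read (steps 𝓐 n c°) (+ 0) (length u)) λ k k<w →
          trans (cong (steps 𝓐 n c′) (trans (cong (λ z → ℤ.- + ⌈ z /2⌉ ℤ.+ + k) (length-w n 1≤n))
                  (ℤP.+-comm (ℤ.- + h) (+ k))))
          (trans (sym (steps-shift c′ c″ (ℤ.- + h) (λ _ → refl) n (+ k)))
          (det° c″ c″-agree n k (subst (k ℕ.<_) (length-w n 1≤n) k<w)))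
      where
      -- `⟨_⟩` places the words of time n ≥ 1 at -h, whereas `Determining` speaks of [0 , |u|); the
      -- shift by h reconciles the two.
      c″ : Config q
      c″ i = c′ (i ℤ.+ ℤ.- + h)
      c″-agree : ∀ k → k ℕ.< P → c″ (ℤ.- + Y ℤ.+ + k) ≡ c° (ℤ.- + Y ℤ.+ + k)
      c″-agree k k<P = trans (cong c′ position)
        (read-agree c° c′ (ℤ.- + Y) (ℤ.- + ⌈ length (w 0) /2⌉) P c′∈ k k<P)
        where
        open ℤSolver.+-*-Solver
        -- Padding u by the same Y on both sides moves the start chosen by `⟨_⟩` by exactly Y, for
        -- either parity of |u|. Hence one shift by h aligns the foot as well.
        position : ℤ.- + Y ℤ.+ + k ℤ.+ ℤ.- + h ≡ ℤ.- + ⌈ length (w 0) /2⌉ ℤ.+ + k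
        position = trans
          (solve 3 (λ y k h → :- y :+ k :+ :- h := :- (y :+ h) :+ k) refl (+ Y) (+ k) (+ h))
          (cong (λ z → ℤ.- z ℤ.+ + k) (trans (sym (ℤP.pos-+ Y h)) (cong +_
            (trans (sym (⌈m+[n+m]/2⌉≡m+⌈n/2⌉ Y (length u))) (cong ⌈_/2⌉ (sym length-w₀))))))
    wall : IsWall 𝓐 w
    wall = record
      { nonempty      = λ n e → contradiction (subst (λ v → 0 ℕ.< length v) e (positive n)) λ ()
      ; propagates    = propagates
      ; nonincreasing = shrinks
      }
      where
      positive : ∀ n → 0 ℕ.< length (w n)
      positive zero      = subst (0 ℕ.<_) (sym length-w₀) 0<P
      positive n@(suc _) = subst (0 ℕ.<_) (sym (length-w n (s≤s z≤n))) (length>0 u u≢[])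
      shrinks : ∀ m n → m ℕ.≤ n → length (w n) ℕ.≤ length (w m)
      shrinks zero      zero      _ = ℕP.≤-refl
      shrinks zero      n@(suc _) _ = subst₂ ℕ._≤_ (sym (length-w n (s≤s z≤n))) (sym length-w₀) u≤P
      shrinks m@(suc _) n@(suc _) _ =
        ℕP.≤-reflexive (trans (length-w n (s≤s z≤n)) (sym (length-w m (s≤s z≤n))))
    isBrick : ∀ k → w (proj₁ eventually-periodic ℕ.* k ℕ.+ n) ≡ u
    -- Strictness of q ^ P < n makes the index positive, so the word there is not the foot.
    isBrick k = trans (w-read (p ℕ.* k ℕ.+ n) (ℕP.≤-trans (ℕP.≤-<-trans z≤n N<n) (ℕP.m≤n+m n (p ℕ.* k))))
      (read-∈ (steps 𝓐 (p ℕ.* k ℕ.+ n) c°) u (+ 0)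
        (cylinder-transfer (steps 𝓐 n c) (steps 𝓐 (p ℕ.* k ℕ.+ n) c°) u (+ 0) (+ 0) c∈ λ i i<u →
          trans (proj₂ (proj₂ eventually-periodic) n (ℕP.<⇒≤ N<n) k (+ i)) (det c° c°-agree n i i<u)))
      where
      p = proj₁ eventually-periodic
      w-read : ∀ n → 1 ℕ.≤ n → w n ≡ read (steps 𝓐 n c°) (+ 0) (length u)
      w-read (suc _) _ = refl

  -- Both occurrences of w lie within the window, so any `c′` agreeing with c there inherits them.
  -- Both columns then evolve as in c, and [0 , |u|) lies between their centres.
  blocked⇒determining : ∀ w m → Blocking w m → m ℕ.< length w → ∀ c a b →
    a ℕ.+ length w ℕ.≤ Y → Y ℕ.+ length u ℕ.≤ b → b ℕ.+ length w ℕ.≤ P →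
    c ∈ [ w ]at (ℤ.- + Y ℤ.+ + a) → c ∈ [ w ]at (ℤ.- + Y ℤ.+ + b) → Determining c
  blocked⇒determining w m blocking m<w c a b a+w≤Y Y+u≤b b+w≤P c∈a c∈b c′ e n k k<u =
    subst (λ i → steps 𝓐 n c′ i ≡ steps 𝓐 n c i) position
      (sym (agree-between c c′ l T
        (blocking c c′ (ℤ.- + Y ℤ.+ + a) c∈a (inherit a (ℕP.≤-trans a+w≤Y (ℕP.m≤m+n Y _)) c∈a))
        (subst (λ x → ∀ n i → ℤ.∣ i ∣ ℕ.≤ r → steps 𝓐 n c (i ℤ.+ x) ≡ steps 𝓐 n c′ (i ℤ.+ x)) right-position
          (blocking c c′ (ℤ.- + Y ℤ.+ + b) c∈b (inherit b b+w≤P c∈b)))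
        initial n t t≤T))
    where
    l = ℤ.- + Y ℤ.+ + a ℤ.+ + m
    -- T is the distance between the two column centres, where the offset m cancels; t is the
    -- distance of cell k from the left centre.
    T = b ℕ.∸ a
    t = (Y ℕ.+ k) ℕ.∸ (a ℕ.+ m)
    a+m≤Y : a ℕ.+ m ℕ.≤ Y
    a+m≤Y = ℕP.≤-trans (ℕP.+-monoʳ-≤ a (ℕP.<⇒≤ m<w)) a+w≤Y
    a≤b : a ℕ.≤ b
    a≤b = ℕP.≤-trans (ℕP.≤-trans (ℕP.m≤m+n a m) a+m≤Y) (ℕP.≤-trans (ℕP.m≤m+n Y _) Y+u≤b)
    inherit : ∀ x → x ℕ.+ length w ℕ.≤ P → c ∈ [ w ]at (ℤ.- + Y ℤ.+ + x) → c′ ∈ [ w ]at (ℤ.- + Y ℤ.+ + x)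
    inherit x x+w≤P c∈ = cylinder-transfer c c′ w (ℤ.- + Y ℤ.+ + x) (ℤ.- + Y ℤ.+ + x) c∈ λ i i<w →
      subst (λ z → c′ z ≡ c z) (-m+[n+k] Y x i)
        (e (x ℕ.+ i) (ℕP.<-≤-trans (ℕP.+-monoʳ-< x i<w) x+w≤P))
    l+ : ∀ t → ℤ.- + Y ℤ.+ + ((a ℕ.+ m) ℕ.+ t) ≡ l ℤ.+ + t
    l+ t = trans (-m+[n+k] Y (a ℕ.+ m) t) (cong (ℤ._+ + t) (-m+[n+k] Y a m))
    right-position : ℤ.- + Y ℤ.+ + b ℤ.+ + m ≡ l ℤ.+ + T
    right-position = trans (sym (-m+[n+k] Y b m)) (trans (cong (λ z → ℤ.- + Y ℤ.+ + z) nat) (l+ T))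
      where
      nat : b ℕ.+ m ≡ (a ℕ.+ m) ℕ.+ T
      nat = trans (cong (ℕ._+ m) (sym (ℕP.m+[n∸m]≡n a≤b)))
        (trans (ℕP.+-assoc a T m) (trans (cong (a ℕ.+_) (ℕP.+-comm T m)) (sym (ℕP.+-assoc a m T))))
    initial : ∀ t → t ℕ.≤ T → c (l ℤ.+ + t) ≡ c′ (l ℤ.+ + t)
    initial t t≤T = subst (λ z → c z ≡ c′ z) (l+ t) (sym (e ((a ℕ.+ m) ℕ.+ t)
      (ℕP.<-≤-trans (subst (ℕ._< b ℕ.+ length w) swap (ℕP.+-mono-≤-< a+t≤b m<w)) b+w≤P)))
      where
      a+t≤b : a ℕ.+ t ℕ.≤ b
      a+t≤b = ℕP.≤-trans (ℕP.+-monoʳ-≤ a t≤T) (ℕP.≤-reflexive (ℕP.m+[n∸m]≡n a≤b))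
      swap : a ℕ.+ t ℕ.+ m ≡ a ℕ.+ m ℕ.+ t
      swap = trans (ℕP.+-assoc a t m) (trans (cong (a ℕ.+_) (ℕP.+-comm t m)) (sym (ℕP.+-assoc a m t)))
    a+m≤Y+k : a ℕ.+ m ℕ.≤ Y ℕ.+ k
    a+m≤Y+k = ℕP.≤-trans a+m≤Y (ℕP.m≤m+n Y k)
    position : l ℤ.+ + t ≡ + k
    position = trans (sym (l+ t)) (trans (cong (λ z → ℤ.- + Y ℤ.+ + z) (ℕP.m+[n∸m]≡n a+m≤Y+k)) (-m+[m+k] Y k))
    t≤T : t ℕ.≤ T
    t≤T = ℕP.≤-trans (ℕP.∸-mono (ℕP.≤-trans (ℕP.+-monoʳ-≤ Y (ℕP.<⇒≤ k<u)) Y+u≤b) (ℕP.m≤m+n a m)) ℕP.≤-refl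

x<y⇒0<y-x : ∀ {x y} → x ℚ.< y → 0ℚ ℚ.< y ℚ.- x
x<y⇒0<y-x {x} {y} x<y = subst (ℚ._< y ℚ.- x) (ℚP.+-inverseʳ x) (ℚP.+-monoˡ-< (ℚ.- x) x<y)

-- The distance in terms of agreement around the origin

module _ {q} (c c′ : Config q) where

  diff-agree : ∀ m s n → (∀ i → ℤ.∣ i ∣ ℕ.< s ℕ.+ m → c i ≡ c′ i) → diff c c′ s n ℚ.≤ ½^ (s ℕ.+ m)
  diff-agree zero    s n       e rewrite ℕP.+-identityʳ s = diff≤ c c′ s n
  diff-agree (suc m) s zero    e = ℚP.<⇒≤ (½^>0 (s ℕ.+ suc m))
  diff-agree (suc m) s (suc n) e
    rewrite dec-true (c (+ s) Fin.≟ c′ (+ s)) (e (+ s) (ℕP.m<m+n s ℕP.0<1+n))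
          | dec-true (c (ℤ.- + s) Fin.≟ c′ (ℤ.- + s))
              (e (ℤ.- + s) (subst (ℕ._< s ℕ.+ suc m) (sym (ℤP.∣-i∣≡∣i∣ (+ s))) (ℕP.m<m+n s ℕP.0<1+n)))
          | ℕP.+-suc s m
    = diff-agree m (suc s) n e

  -- A disagreement at t + s with t ≤ k would give `diff` a value of at least ½^(k + s). The
  -- condition k < n ensures that the search gets that far instead of ending with its default 0.
  diff-small : ∀ k s n → k ℕ.< n → diff c c′ s n ℚ.< ½^ (k ℕ.+ s) →
               ∀ t → t ℕ.≤ k → c (+ (t ℕ.+ s)) ≡ c′ (+ (t ℕ.+ s)) × c (ℤ.- + (t ℕ.+ s)) ≡ c′ (ℤ.- + (t ℕ.+ s))
  diff-small k s (suc n) k<n h t t≤k with c (+ s) Fin.≟ c′ (+ s) | c (ℤ.- + s) Fin.≟ c′ (ℤ.- + s)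
  ... | no _   | _     = ⊥-elim (ℚP.<-irrefl refl (ℚP.<-≤-trans h (½^-anti k s)))
  ... | yes _  | no _  = ⊥-elim (ℚP.<-irrefl refl (ℚP.<-≤-trans h (½^-anti k s)))
  diff-small k       s (suc n) _         h zero    _         | yes p | yes p′ = p , p′
  diff-small (suc k) s (suc n) (s≤s k<n) h (suc t) (s≤s t≤k) | yes _ | yes _  =
    subst (λ z → c (+ z) ≡ c′ (+ z) × c (ℤ.- + z) ≡ c′ (ℤ.- + z)) (ℕP.+-suc t s)
      (diff-small k (suc s) n k<n (subst (λ z → diff c c′ (suc s) n ℚ.< ½^ z) (sym (ℕP.+-suc k s)) h) t t≤k)

  d<⇒agree : ∀ k → d c c′ < fromℚ (½^ k) → ∀ i → ℤ.∣ i ∣ ℕ.≤ k → c i ≡ c′ i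
  d<⇒agree k (δ , 0<δ , N , h) i i≤k = sign i (diff-small k 0 n (ℕP.m≤n+m (suc k) N) small ℤ.∣ i ∣ i≤k)
    where
    -- Late enough both for the inequality of reals to hold and for the search to cover the distance
    -- k.
    n = N ℕ.+ suc k
    small : diff c c′ 0 n ℚ.< ½^ (k ℕ.+ 0)
    small = subst (λ z → diff c c′ 0 n ℚ.< ½^ z) (sym (ℕP.+-identityʳ k))
      (ℚP.<-trans (subst (ℚ._< diff c c′ 0 n ℚ.+ δ) (ℚP.+-identityʳ _) (ℚP.+-monoʳ-< (diff c c′ 0 n) 0<δ))
        (h n (ℕP.m≤m+n N (suc k))))
    sign : ∀ i → c (+ (ℤ.∣ i ∣ ℕ.+ 0)) ≡ c′ (+ (ℤ.∣ i ∣ ℕ.+ 0)) ×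
                 c (ℤ.- + (ℤ.∣ i ∣ ℕ.+ 0)) ≡ c′ (ℤ.- + (ℤ.∣ i ∣ ℕ.+ 0)) → c i ≡ c′ i
    sign (+ m)    (e , _) = subst (λ z → c (+ z) ≡ c′ (+ z)) (ℕP.+-identityʳ m) e
    sign -[1+ m ] (_ , e) = subst (λ z → c -[1+ z ] ≡ c′ -[1+ z ]) (ℕP.+-identityʳ m) e

  agree⇒d< : ∀ m {η : ℝ} {δ N} → ½^ m ℚ.< δ → (∀ n → N ℕ.≤ n → 0ℚ ℚ.+ δ ℚ.< seq η n) →
             (∀ i → ℤ.∣ i ∣ ℕ.< m → c i ≡ c′ i) → d c c′ < η
  agree⇒d< m {η} {δ} {N} ½ᵐ<δ h e = δ ℚ.- ½^ m , x<y⇒0<y-x ½ᵐ<δ , N , λ n N≤n →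
    ℚP.≤-<-trans (ℚP.+-monoˡ-≤ (δ ℚ.- ½^ m) (diff-agree m 0 n e))
      (subst (ℚ._< seq η n) (lem δ (½^ m)) (h n N≤n))
    where
    lem : ∀ δ x → 0ℚ ℚ.+ δ ≡ x ℚ.+ (δ ℚ.- x)
    lem = +-*-Solver.solve 2 (λ δ x → con 0ℚ :+ δ := x :+ (δ :- x)) refl
      where open +-*-Solver

-- Blocking words of a non-sensitive automaton

module NonSensitivity {q} (em : ExcludedMiddle 0ℓ) (𝓐 : CellularAutomaton q) (¬sens : ¬ Sensitive 𝓐) where
  open Dynamics 𝓐

  ¬¬-elim : ∀ {A : Set} → ¬ ¬ A → A
  ¬¬-elim = decidable-stable em

  Stable : ℕ → Config q → ℕ → Set
  Stable k c m = ∀ c′ → (∀ i → ℤ.∣ i ∣ ℕ.< m → c i ≡ c′ i) →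
                 ∀ n i → ℤ.∣ i ∣ ℕ.≤ k → steps 𝓐 n c i ≡ steps 𝓐 n c′ i

  -- If no configuration were stable at scale k, then ½^ k would be a constant of sensitivity. The
  -- configuration found may depend on k; a single scale, k = r, is what a blocking word takes.
  stable-exists : ∀ k → ∃[ c ] ∃[ m ] Stable k c m
  stable-exists k = ¬¬-elim λ none → ¬sens (fromℚ (½^ k) , positive , λ c η 0<η → ¬¬-elim λ close →
    none (c , stable c η 0<η close))
    where
    positive : 0ℝ < fromℚ (½^ k)
    positive = ½ ℚ.* ½^ k , half-pos (½^>0 k) , 0 , λ _ _ →
      subst (0ℚ ℚ.+ ½ ℚ.* ½^ k ℚ.<_) (halves (½^ k)) (ℚP.+-monoˡ-< (½ ℚ.* ½^ k) (half-pos (½^>0 k)))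
    stable : ∀ c η → 0ℝ < η →
      ¬ (∃[ c′ ] (d c c′ < η × ∃[ n ] (fromℚ (½^ k) ≤ d (steps 𝓐 n c) (steps 𝓐 n c′)))) →
      ∃[ m ] Stable k c m
    stable c η (δ , 0<δ , N , h) close with ½^-small δ 0<δ
    ... | m , ½ᵐ<δ = m , λ c′ e n i i≤k → d<⇒agree (steps 𝓐 n c) (steps 𝓐 n c′) k
      -- `_≤_` on reals is the negation of `_<_`, so the failure `far` of being close is itself the
      -- lower bound on the distance.
      (¬¬-elim λ far → close (c′ , agree⇒d< c c′ m {η} ½ᵐ<δ h e , n , far)) i i≤k

  -- w is e on [-m , m]. A configuration containing w agrees, after a shift, with e on that ball, so
  -- its column follows the orbit of e.
  stable⇒blocking : ∀ e m → Stable r e m → ∃[ w ] ∃[ m ] (Blocking w m × m ℕ.< length w)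
  stable⇒blocking e m stable = w , m , blocking , subst (m ℕ.<_) (sym |w|) (s≤s (ℕP.m≤m+n m m))
    where
    w = read e (ℤ.- + m) (suc (m ℕ.+ m))
    |w| = length-read e (ℤ.- + m) (suc (m ℕ.+ m))
    orbit : ∀ c j → c ∈ [ w ]at j → ∀ n i → ℤ.∣ i ∣ ℕ.≤ r →
            steps 𝓐 n e i ≡ steps 𝓐 n c (i ℤ.+ (j ℤ.+ + m))
    orbit c j c∈ n i i≤r = trans
      (stable (λ i → c (i ℤ.+ (j ℤ.+ + m))) agree n i i≤r)
      (steps-shift c (λ i → c (i ℤ.+ (j ℤ.+ + m))) (j ℤ.+ + m) (λ _ → refl) n i)
      where
      offset : ∀ i → ℤ.∣ i ∣ ℕ.< m → ∃[ k ] (k ℕ.< suc (m ℕ.+ m) × ℤ.- + m ℤ.+ + k ≡ i)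
      offset (+ k)    k<m = m ℕ.+ k , s≤s (ℕP.+-monoʳ-≤ m (ℕP.<⇒≤ k<m))
        , trans (cong (ℤ._+_ (ℤ.- + m)) (ℤP.pos-+ m k))
          (trans (sym (ℤP.+-assoc (ℤ.- + m) (+ m) (+ k)))
          (trans (cong (ℤ._+ + k) (ℤP.+-inverseˡ (+ m))) (ℤP.+-identityˡ (+ k))))
      offset -[1+ k ] k<m = m ℕ.∸ suc k , s≤s (ℕP.≤-trans (ℕP.m∸n≤m m (suc k)) (ℕP.m≤m+n m m))
        , trans (cong (ℤ._+_ (ℤ.- + m)) (sym (trans (ℤP.m-n≡m⊖n m (suc k)) (ℤP.⊖-≥ (ℕP.<⇒≤ k<m)))))
          (trans (sym (ℤP.+-assoc (ℤ.- + m) (+ m) -[1+ k ]))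
          (trans (cong (ℤ._+ -[1+ k ]) (ℤP.+-inverseˡ (+ m))) (ℤP.+-identityˡ -[1+ k ])))
      agree : ∀ i → ℤ.∣ i ∣ ℕ.< m → e i ≡ c (i ℤ.+ (j ℤ.+ + m))
      agree i i<m with offset i i<m
      ... | k , k< , refl = trans (sym (read-agree e c (ℤ.- + m) j (suc (m ℕ.+ m)) c∈ k k<))
        (cong c (solve 3 (λ j m k → j :+ k := :- m :+ k :+ (j :+ m)) refl j (+ m) (+ k)))
        where open ℤSolver.+-*-Solver
    blocking : Blocking w m
    blocking c c′ j c∈ c′∈ n i i≤r = trans (sym (orbit c j c∈ n i i≤r)) (orbit c′ j c′∈ n i i≤r)

  blocking-word : ∃[ w ] ∃[ m ] (Blocking w m × m ℕ.< length w)
  blocking-word = let (e , m , stable) = stable-exists r in stable⇒blocking e m stable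

-- Finite sums and products of rationals

∑ : ∀ {A : Set} → (A → ℚ) → List A → ℚ
∑ f = List.foldr (λ x s → f x ℚ.+ s) 0ℚ

infixr 8 _^^_
_^^_ : ℚ → ℕ → ℚ
x ^^ zero  = 1ℚ
x ^^ suc n = x ℚ.* x ^^ n

*-mono-nonNeg : ∀ {a b c d} → 0ℚ ℚ.≤ a → 0ℚ ℚ.≤ d → a ℚ.≤ b → c ℚ.≤ d → a ℚ.* c ℚ.≤ b ℚ.* d
*-mono-nonNeg {a} {b} {c} {d} 0≤a 0≤d a≤b c≤d = ℚP.≤-trans
  (ℚP.*-monoˡ-≤-nonNeg a {{ℚ.nonNegative 0≤a}} c≤d)
  (ℚP.*-monoʳ-≤-nonNeg d {{ℚ.nonNegative 0≤d}} a≤b)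

0≤1 : 0ℚ ℚ.≤ 1ℚ
0≤1 = ℚP.<⇒≤ (ℚP.positive⁻¹ 1ℚ)

*-nonNeg : ∀ {a b} → 0ℚ ℚ.≤ a → 0ℚ ℚ.≤ b → 0ℚ ℚ.≤ a ℚ.* b
*-nonNeg {a} {b} 0≤a 0≤b = subst (ℚ._≤ a ℚ.* b) (ℚP.*-zeroʳ a)
  (ℚP.*-monoˡ-≤-nonNeg a {{ℚ.nonNegative 0≤a}} 0≤b)

*-pos : ∀ {a b} → 0ℚ ℚ.< a → 0ℚ ℚ.< b → 0ℚ ℚ.< a ℚ.* b
*-pos {a} {b} 0<a 0<b = subst (ℚ._< a ℚ.* b) (ℚP.*-zeroʳ a)
  (ℚP.*-monoʳ-<-pos a {{ℚ.positive 0<a}} 0<b)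

+-nonNeg : ∀ {a b} → 0ℚ ℚ.≤ a → 0ℚ ℚ.≤ b → 0ℚ ℚ.≤ a ℚ.+ b
+-nonNeg = ℚP.+-mono-≤ {0ℚ} {_} {0ℚ}

^^-pos : ∀ {x} n → 0ℚ ℚ.< x → 0ℚ ℚ.< x ^^ n
^^-pos zero    0<x = ℚP.positive⁻¹ 1ℚ
^^-pos (suc n) 0<x = *-pos 0<x (^^-pos n 0<x)

^^-nonNeg : ∀ {x} n → 0ℚ ℚ.≤ x → 0ℚ ℚ.≤ x ^^ n
^^-nonNeg zero    0≤x = 0≤1
^^-nonNeg (suc n) 0≤x = *-nonNeg 0≤x (^^-nonNeg n 0≤x)

^^-mono : ∀ {x y} n → 0ℚ ℚ.≤ x → x ℚ.≤ y → x ^^ n ℚ.≤ y ^^ n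
^^-mono zero    0≤x x≤y = ℚP.≤-refl
^^-mono (suc n) 0≤x x≤y = *-mono-nonNeg 0≤x (^^-nonNeg n (ℚP.≤-trans 0≤x x≤y)) x≤y (^^-mono n 0≤x x≤y)

-- With y = ½^(k + 1) ≤ 1, one has (1 + y/2)(1 + y) ≤ 1 + 2y. Two halvings per factor thus suffice,
-- whence the exponent 2n + k.
[1+x]^n≤1+½^k : ∀ n k x → 0ℚ ℚ.≤ x → x ℚ.≤ ½^ (n ℕ.* 2 ℕ.+ k) → (1ℚ ℚ.+ x) ^^ n ℚ.≤ 1ℚ ℚ.+ ½^ k
[1+x]^n≤1+½^k zero    k x 0≤x x≤ =
  subst (ℚ._≤ 1ℚ ℚ.+ ½^ k) (ℚP.+-identityʳ 1ℚ) (ℚP.+-monoʳ-≤ 1ℚ (ℚP.<⇒≤ (½^>0 k)))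
[1+x]^n≤1+½^k (suc n) k x 0≤x x≤ = begin
  (1ℚ ℚ.+ x) ℚ.* (1ℚ ℚ.+ x) ^^ n
    ≤⟨ *-mono-nonNeg (+-nonNeg 0≤1 0≤x) (+-nonNeg 0≤1 0≤y)
         (ℚP.+-monoʳ-≤ 1ℚ x≤½y) ([1+x]^n≤1+½^k n (suc k) x 0≤x x≤′) ⟩
  (1ℚ ℚ.+ ½ ℚ.* y) ℚ.* (1ℚ ℚ.+ y)
    ≡⟨ expand y ⟩
  (1ℚ ℚ.+ (½ ℚ.* y ℚ.+ y)) ℚ.+ (½ ℚ.* y) ℚ.* y
    ≤⟨ ℚP.+-monoʳ-≤ (1ℚ ℚ.+ (½ ℚ.* y ℚ.+ y)) (ℚP.*-monoˡ-≤-nonNeg (½ ℚ.* y) {{ℚ.nonNegative 0≤½y}} y≤1) ⟩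
  (1ℚ ℚ.+ (½ ℚ.* y ℚ.+ y)) ℚ.+ (½ ℚ.* y) ℚ.* 1ℚ
    ≡⟨ collect (½ ℚ.* y) y ⟩
  1ℚ ℚ.+ (y ℚ.+ (½ ℚ.* y ℚ.+ ½ ℚ.* y))
    ≡⟨ cong (λ z → 1ℚ ℚ.+ (y ℚ.+ z)) (halves y) ⟩
  1ℚ ℚ.+ (y ℚ.+ y)
    ≡⟨ cong (1ℚ ℚ.+_) (halves (½^ k)) ⟩
  1ℚ ℚ.+ ½^ k ∎
  where
  open ℚP.≤-Reasoning
  y = ½^ (suc k)
  0≤y : 0ℚ ℚ.≤ y
  0≤y = ℚP.<⇒≤ (½^>0 (suc k))
  0≤½y : 0ℚ ℚ.≤ ½ ℚ.* y
  0≤½y = ℚP.<⇒≤ (½^>0 (suc (suc k)))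
  y≤1 : y ℚ.≤ 1ℚ
  y≤1 = subst (λ z → ½^ z ℚ.≤ 1ℚ) (ℕP.+-identityʳ (suc k)) (½^-anti (suc k) 0)
  2+2n+k : ∀ n → suc (suc (n ℕ.* 2 ℕ.+ k)) ≡ n ℕ.* 2 ℕ.+ suc (suc k)
  2+2n+k n = sym (trans (ℕP.+-suc (n ℕ.* 2) (suc k)) (cong suc (ℕP.+-suc (n ℕ.* 2) k)))
  x≤½y : x ℚ.≤ ½ ℚ.* y
  x≤½y = ℚP.≤-trans x≤ (subst (λ z → ½^ z ℚ.≤ ½^ (suc (suc k))) (sym (2+2n+k n)) (½^-anti (n ℕ.* 2) (suc (suc k))))
  x≤′ : x ℚ.≤ ½^ (n ℕ.* 2 ℕ.+ suc k)
  x≤′ = ℚP.≤-trans x≤ (subst (λ z → ½^ (suc (suc (n ℕ.* 2 ℕ.+ k))) ℚ.≤ ½^ z) (sym (ℕP.+-suc (n ℕ.* 2) k))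
          (½^-anti 1 (suc (n ℕ.* 2 ℕ.+ k))))
  expand : ∀ y → (1ℚ ℚ.+ ½ ℚ.* y) ℚ.* (1ℚ ℚ.+ y) ≡ (1ℚ ℚ.+ (½ ℚ.* y ℚ.+ y)) ℚ.+ (½ ℚ.* y) ℚ.* y
  expand y = lem (½ ℚ.* y) y
    where
    lem : ∀ h y → (1ℚ ℚ.+ h) ℚ.* (1ℚ ℚ.+ y) ≡ (1ℚ ℚ.+ (h ℚ.+ y)) ℚ.+ h ℚ.* y
    lem = +-*-Solver.solve 2 (λ h y → (con 1ℚ :+ h) :* (con 1ℚ :+ y) := (con 1ℚ :+ (h :+ y)) :+ h :* y) refl
      where open +-*-Solver
  collect : ∀ h y → (1ℚ ℚ.+ (h ℚ.+ y)) ℚ.+ h ℚ.* 1ℚ ≡ 1ℚ ℚ.+ (y ℚ.+ (h ℚ.+ h))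
  collect = +-*-Solver.solve 2 (λ h y → (con 1ℚ :+ (h :+ y)) :+ h :* con 1ℚ := con 1ℚ :+ (y :+ (h :+ h))) refl
    where open +-*-Solver

-- A division-free Bernoulli inequality, by induction from (1 - θ)(1 + (n + 1)θ) = 1 + nθ - (n +
-- 1)θ².
β^n[1+nθ]≤1 : ∀ {β θ} n → 0ℚ ℚ.≤ β → 0ℚ ℚ.≤ θ → β ℚ.≤ 1ℚ ℚ.- θ → β ^^ n ℚ.* (1ℚ ℚ.+ θ ℚ.* ι n) ℚ.≤ 1ℚ
β^n[1+nθ]≤1 {β} {θ} zero    0≤β 0≤θ β≤ = ℚP.≤-reflexive
  (cong (λ z → 1ℚ ℚ.* (1ℚ ℚ.+ z)) (ℚP.*-zeroʳ θ))
β^n[1+nθ]≤1 {β} {θ} (suc n) 0≤β 0≤θ β≤ = begin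
  β ℚ.* β ^^ n ℚ.* (1ℚ ℚ.+ θ ℚ.* ι (suc n))
    ≡⟨ assoc β (β ^^ n) (1ℚ ℚ.+ θ ℚ.* ι (suc n)) ⟩
  β ^^ n ℚ.* (β ℚ.* (1ℚ ℚ.+ θ ℚ.* ι (suc n)))
    ≤⟨ ℚP.*-monoˡ-≤-nonNeg (β ^^ n) {{ℚ.nonNegative (^^-nonNeg n 0≤β)}}
        (ℚP.*-monoʳ-≤-nonNeg (1ℚ ℚ.+ θ ℚ.* ι (suc n)) {{ℚ.nonNegative 0≤1+}} β≤) ⟩
  β ^^ n ℚ.* ((1ℚ ℚ.- θ) ℚ.* (1ℚ ℚ.+ θ ℚ.* ι (suc n)))
    ≤⟨ ℚP.*-monoˡ-≤-nonNeg (β ^^ n) {{ℚ.nonNegative (^^-nonNeg n 0≤β)}} drop ⟩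
  β ^^ n ℚ.* (1ℚ ℚ.+ θ ℚ.* ι n)
    ≤⟨ β^n[1+nθ]≤1 n 0≤β 0≤θ β≤ ⟩
  1ℚ ∎
  where
  open ℚP.≤-Reasoning
  0≤1+ : 0ℚ ℚ.≤ 1ℚ ℚ.+ θ ℚ.* ι (suc n)
  0≤1+ = +-nonNeg 0≤1 (*-nonNeg 0≤θ (0≤ι (suc n)))
  assoc : ∀ a b c → a ℚ.* b ℚ.* c ≡ b ℚ.* (a ℚ.* c)
  assoc = +-*-Solver.solve 3 (λ a b c → a :* b :* c := b :* (a :* c)) refl
    where open +-*-Solver
  expand : ∀ t i → (1ℚ ℚ.- t) ℚ.* (1ℚ ℚ.+ t ℚ.* (1ℚ ℚ.+ i)) ℚ.+ t ℚ.* (t ℚ.* (1ℚ ℚ.+ i)) ≡ 1ℚ ℚ.+ t ℚ.* i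
  expand = +-*-Solver.solve 2
    (λ t i → (con 1ℚ :- t) :* (con 1ℚ :+ t :* (con 1ℚ :+ i)) :+ t :* (t :* (con 1ℚ :+ i)) := con 1ℚ :+ t :* i) refl
    where open +-*-Solver
  drop : (1ℚ ℚ.- θ) ℚ.* (1ℚ ℚ.+ θ ℚ.* ι (suc n)) ℚ.≤ 1ℚ ℚ.+ θ ℚ.* ι n
  drop = subst₂ ℚ._≤_ (ℚP.+-identityʳ _) (expand θ (ι n))
    (ℚP.+-monoʳ-≤ ((1ℚ ℚ.- θ) ℚ.* (1ℚ ℚ.+ θ ℚ.* ι (suc n))) (*-nonNeg 0≤θ (*-nonNeg 0≤θ (0≤ι (suc n)))))

-- n is chosen before β, since β will be the weight of `others w` at a varying index of the
-- approximating sequences. The choice εθn ≥ 1 makes β ^^ n ≥ ε contradict the previous inequality.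
^^-vanishes : ∀ θ ε → 0ℚ ℚ.< θ → 0ℚ ℚ.< ε →
              ∃[ n ] (∀ β → 0ℚ ℚ.≤ β → β ℚ.≤ 1ℚ ℚ.- θ → β ^^ n ℚ.< ε)
^^-vanishes θ ε 0<θ 0<ε = n , λ β 0≤β β≤ → ℚP.≰⇒> λ ε≤β^n → ℚP.<-irrefl refl (begin-strict
  1ℚ                              ≤⟨ proj₂ (archimedean (ε ℚ.* θ) (*-pos 0<ε 0<θ)) ⟩
  ε ℚ.* θ ℚ.* ι n                 ≡⟨ ℚP.*-assoc ε θ (ι n) ⟩
  ε ℚ.* x                         ≡⟨ sym (ℚP.+-identityˡ (ε ℚ.* x)) ⟩
  0ℚ ℚ.+ ε ℚ.* x                  <⟨ ℚP.+-monoˡ-< (ε ℚ.* x) 0<ε ⟩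
  ε ℚ.+ ε ℚ.* x                   ≡⟨ lem ε x ⟩
  ε ℚ.* (1ℚ ℚ.+ x)                ≤⟨ ℚP.*-monoʳ-≤-nonNeg (1ℚ ℚ.+ x) {{ℚ.nonNegative 0≤1+x}} ε≤β^n ⟩
  β ^^ n ℚ.* (1ℚ ℚ.+ x)           ≤⟨ β^n[1+nθ]≤1 n 0≤β (ℚP.<⇒≤ 0<θ) β≤ ⟩
  1ℚ                              ∎)
  where
  open ℚP.≤-Reasoning
  n = proj₁ (archimedean (ε ℚ.* θ) (*-pos 0<ε 0<θ))
  x = θ ℚ.* ι n
  0≤1+x : 0ℚ ℚ.≤ 1ℚ ℚ.+ x
  0≤1+x = +-nonNeg 0≤1 (*-nonNeg (ℚP.<⇒≤ 0<θ) (0≤ι n))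
  lem : ∀ e x → e ℚ.+ e ℚ.* x ≡ e ℚ.* (1ℚ ℚ.+ x)
  lem = +-*-Solver.solve 2 (λ e x → e :+ e :* x := e :* (con 1ℚ :+ x)) refl
    where open +-*-Solver

∑-++ : ∀ {A : Set} (f : A → ℚ) xs ys → ∑ f (xs ++ ys) ≡ ∑ f xs ℚ.+ ∑ f ys
∑-++ f []       ys = sym (ℚP.+-identityˡ (∑ f ys))
∑-++ f (x ∷ xs) ys = trans (cong (f x ℚ.+_) (∑-++ f xs ys)) (sym (ℚP.+-assoc (f x) (∑ f xs) (∑ f ys)))

∑-map : ∀ {A B : Set} (f : B → ℚ) (g : A → B) xs → ∑ f (List.map g xs) ≡ ∑ (f ∘ g) xs
∑-map f g []       = refl
∑-map f g (x ∷ xs) = cong (f (g x) ℚ.+_) (∑-map f g xs)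

∑-nonNeg : ∀ {A : Set} (f : A → ℚ) xs → (∀ x → 0ℚ ℚ.≤ f x) → 0ℚ ℚ.≤ ∑ f xs
∑-nonNeg f []       0≤f = ℚP.≤-refl
∑-nonNeg f (x ∷ xs) 0≤f = +-nonNeg (0≤f x) (∑-nonNeg f xs 0≤f)

∑-cartesianProductWith : ∀ {A B C : Set} (h : C → ℚ) (α : A → ℚ) (β : B → ℚ) (f : A → B → C) →
  (∀ x y → h (f x y) ≡ α x ℚ.* β y) → ∀ xs ys → ∑ h (cartesianProductWith f xs ys) ≡ ∑ α xs ℚ.* ∑ β ys
∑-cartesianProductWith h α β f e []       ys = sym (ℚP.*-zeroˡ (∑ β ys))
∑-cartesianProductWith h α β f e (x ∷ xs) ys =
  trans (∑-++ h (List.map (f x) ys) (cartesianProductWith f xs ys))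
  (trans (cong₂ ℚ._+_ (row ys) (∑-cartesianProductWith h α β f e xs ys))
  (sym (ℚP.*-distribʳ-+ (∑ β ys) (α x) (∑ α xs))))
  where
  row : ∀ ys → ∑ h (List.map (f x) ys) ≡ α x ℚ.* ∑ β ys
  row []       = sym (ℚP.*-zeroʳ (α x))
  row (y ∷ ys) = trans (cong₂ ℚ._+_ (e x y) (row ys)) (sym (ℚP.*-distribˡ-+ (α x) (β y) (∑ β ys)))

-- Weights of words

module Weights {q : ℕ} where

  -- P will be one rational approximation of the letter probabilities, so its sum is not assumed to
  -- be 1.
  W : (Fin q → ℚ) → Word q → ℚ
  W P []      = 1ℚ
  W P (a ∷ u) = P a ℚ.* W P u

  W-++ : ∀ P u v → W P (u ++ v) ≡ W P u ℚ.* W P v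
  W-++ P []      v = sym (ℚP.*-identityˡ (W P v))
  W-++ P (a ∷ u) v = trans (cong (P a ℚ.*_) (W-++ P u v)) (sym (ℚP.*-assoc (P a) (W P u) (W P v)))

  W-nonNeg : ∀ {P} → (∀ a → 0ℚ ℚ.≤ P a) → ∀ u → 0ℚ ℚ.≤ W P u
  W-nonNeg 0≤P []      = 0≤1
  W-nonNeg 0≤P (a ∷ u) = *-nonNeg (0≤P a) (W-nonNeg 0≤P u)

  W-bound : ∀ {P δ} → 0ℚ ℚ.≤ δ → (∀ a → δ ℚ.≤ P a) → ∀ u → δ ^^ length u ℚ.≤ W P u
  W-bound 0≤δ δ≤P []      = ℚP.≤-refl
  W-bound 0≤δ δ≤P (a ∷ u) =
    *-mono-nonNeg 0≤δ (W-nonNeg (λ a → ℚP.≤-trans 0≤δ (δ≤P a)) u) (δ≤P a) (W-bound 0≤δ δ≤P u)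

  words : ℕ → List (Word q)
  words zero    = [] ∷ []
  words (suc n) = cartesianProductWith _∷_ (allFin q) (words n)

  ∈-words : ∀ u → u Membership.∈ words (length u)
  ∈-words []      = here refl
  ∈-words (a ∷ u) = ∈-cartesianProductWith⁺ _∷_ (∈-allFin a) (∈-words u)

  ∑-words : ∀ P n → ∑ (W P) (words n) ≡ ∑ P (allFin q) ^^ n
  ∑-words P zero    = ℚP.+-identityʳ 1ℚ
  ∑-words P (suc n) = trans (∑-cartesianProductWith (W P) P (W P) _∷_ (λ _ _ → refl) (allFin q) (words n))
    (cong (∑ P (allFin q) ℚ.*_) (∑-words P n))

  _≟ʷ_ : (u v : Word q) → Dec (u ≡ v)
  _≟ʷ_ = ListP.≡-dec Fin._≟_

  others : Word q → List (Word q)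
  others w = filter (λ v → ¬? (v ≟ʷ w)) (words (length w))

  ∑-remove : ∀ (f : Word q → ℚ) → (∀ v → 0ℚ ℚ.≤ f v) → ∀ w L →
    ∑ f (filter (λ v → ¬? (v ≟ʷ w)) L) ℚ.≤ ∑ f L
  ∑-remove f 0≤f w []      = ℚP.≤-refl
  ∑-remove f 0≤f w (v ∷ L) with v ≟ʷ w
  ... | no  _ = ℚP.+-monoʳ-≤ (f v) (∑-remove f 0≤f w L)
  ... | yes _ = subst (ℚ._≤ f v ℚ.+ ∑ f L) (ℚP.+-identityˡ _) (ℚP.+-mono-≤ (0≤f v) (∑-remove f 0≤f w L))

  ∑-remove-∈ : ∀ (f : Word q → ℚ) → (∀ v → 0ℚ ℚ.≤ f v) → ∀ w L → w Membership.∈ L →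
    f w ℚ.+ ∑ f (filter (λ v → ¬? (v ≟ʷ w)) L) ℚ.≤ ∑ f L
  ∑-remove-∈ f 0≤f w (v ∷ L) w∈ with v ≟ʷ w
  ∑-remove-∈ f 0≤f w (v ∷ L) w∈           | yes refl = ℚP.+-monoʳ-≤ (f v) (∑-remove f 0≤f w L)
  ∑-remove-∈ f 0≤f w (v ∷ L) (here refl)  | no v≢w   = contradiction refl v≢w
  ∑-remove-∈ f 0≤f w (v ∷ L) (there w∈L)  | no _     =
    subst (ℚ._≤ f v ℚ.+ ∑ f L) (lem (f v) (f w) _) (ℚP.+-monoʳ-≤ (f v) (∑-remove-∈ f 0≤f w L w∈L))
    where
    lem : ∀ a b c → a ℚ.+ (b ℚ.+ c) ≡ b ℚ.+ (a ℚ.+ c)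
    lem = +-*-Solver.solve 3 (λ a b c → a :+ (b :+ c) := b :+ (a :+ c)) refl
      where open +-*-Solver

  -- Only aligned occurrences of w are excluded, so that the blocks vary independently and the total
  -- weight is a power; w may still occur across block boundaries.
  avoiding : Word q → ℕ → List (Word q)
  avoiding w zero    = [] ∷ []
  avoiding w (suc n) = cartesianProductWith _++_ (others w) (avoiding w n)

  ∑-avoiding : ∀ P w n → ∑ (W P) (avoiding w n) ≡ ∑ (W P) (others w) ^^ n
  ∑-avoiding P w zero    = ℚP.+-identityʳ 1ℚ
  ∑-avoiding P w (suc n) =
    trans (∑-cartesianProductWith (W P) (W P) (W P) _++_ (W-++ P) (others w) (avoiding w n))
    (cong (∑ (W P) (others w) ℚ.*_) (∑-avoiding P w n))

  -- All words of length |w| weigh at most 1 + ½ δ^|w| together, and w alone at least δ^|w|. Half of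
  -- the weight of w pays for the error in the total, and the other half remains as the gap below 1.
  ∑-others : ∀ {P δ} k w → 0ℚ ℚ.≤ δ → (∀ a → δ ℚ.≤ P a) →
    ½^ k ℚ.≤ ½ ℚ.* δ ^^ length w →
    ∑ P (allFin q) ℚ.≤ 1ℚ ℚ.+ ½^ (length w ℕ.* 2 ℕ.+ k) →
    ∑ (W P) (others w) ℚ.≤ 1ℚ ℚ.- ½ ℚ.* δ ^^ length w
  ∑-others {P} {δ} k w 0≤δ δ≤P ½ᵏ≤ T≤ = subst₂ ℚ._≤_ (lem₁ (W P w) (∑ (W P) (others w)))
    (trans (cong (λ z → 1ℚ ℚ.+ ½ ℚ.* δᵐ ℚ.- z) (sym (halves δᵐ))) (lem₂ (½ ℚ.* δᵐ)))
    (ℚP.+-mono-≤ {W P w ℚ.+ ∑ (W P) (others w)} sum≤ (ℚP.neg-antimono-≤ (W-bound 0≤δ δ≤P w)))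
    where
    δᵐ = δ ^^ length w
    0≤P : ∀ a → 0ℚ ℚ.≤ P a
    0≤P a = ℚP.≤-trans 0≤δ (δ≤P a)
    lem₁ : ∀ w o → (w ℚ.+ o) ℚ.- w ≡ o
    lem₁ = +-*-Solver.solve 2 (λ w o → (w :+ o) :- w := o) refl
      where open +-*-Solver
    lem₂ : ∀ h → 1ℚ ℚ.+ h ℚ.- (h ℚ.+ h) ≡ 1ℚ ℚ.- h
    lem₂ = +-*-Solver.solve 1 (λ h → con 1ℚ :+ h :- (h :+ h) := con 1ℚ :- h) refl
      where open +-*-Solver
    sum≤ : W P w ℚ.+ ∑ (W P) (others w) ℚ.≤ 1ℚ ℚ.+ ½ ℚ.* δᵐ
    sum≤ = ℚP.≤-trans (∑-remove-∈ (W P) (W-nonNeg 0≤P) w (words (length w)) (∈-words w))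
      (ℚP.≤-trans (ℚP.≤-reflexive (∑-words P (length w)))
      (ℚP.≤-trans (^^-mono (length w) (∑-nonNeg P (allFin q) 0≤P) T≤)
      (ℚP.≤-trans ([1+x]^n≤1+½^k (length w) k _ (ℚP.<⇒≤ (½^>0 (length w ℕ.* 2 ℕ.+ k))) ℚP.≤-refl)
        (ℚP.+-monoʳ-≤ 1ℚ ½ᵏ≤))))

-- Weights under a Bernoulli measure

seq-sum : ∀ {A : Set} (f : A → ℝ) L n → seq (sum (List.map f L)) n ≡ ∑ (λ a → seq (f a) n) L
seq-sum f []      n = refl
seq-sum f (x ∷ L) n = cong (seq (f x) n ℚ.+_) (seq-sum f L n)

module BernoulliWeights {q} (p : Fin q → ℝ) where
  open Weights {q}

  letter : ℕ → Fin q → ℚ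
  letter n a = seq (p a) n

  weight : Word q → ℕ → ℚ
  weight u n = W (letter n) u

  count : Word q → Fin q → ℕ
  count u a = length (filter (a Fin.≟_) u)

  powers : (Fin q → ℕ) → List (Fin q) → ℕ → ℚ
  powers f L = seq (product (List.map (λ a → p a ^ f a) L))

  count-≢ : ∀ {a b} u → a ≢ b → count (b ∷ u) a ≡ count u a
  count-≢ {a} u a≢b = cong length (ListP.filter-reject (a Fin.≟_) a≢b)

  count-≡ : ∀ a u → count (a ∷ u) a ≡ suc (count u a)
  count-≡ a u = cong length (ListP.filter-accept (a Fin.≟_) refl)

  powers-∷-∉ : ∀ b u n L → All (b ≢_) L → powers (count (b ∷ u)) L n ≡ powers (count u) L n
  powers-∷-∉ b u n []      _          = refl
  powers-∷-∉ b u n (a ∷ L) (b≢a ∷ b∉) = cong₂ ℚ._*_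
    (cong (λ k → seq (p a ^ k) n) (count-≢ u (b≢a ∘ sym))) (powers-∷-∉ b u n L b∉)

  -- As b occurs exactly once in L, exactly one factor gains a power of `p b`. L is general for the
  -- sake of induction over the alphabet.
  powers-∷-∈ : ∀ b u n L → Unique L → b Membership.∈ L →
               powers (count (b ∷ u)) L n ≡ letter n b ℚ.* powers (count u) L n
  powers-∷-∈ b u n (b ∷ L) (b∉ ∷ _) (here refl) = trans (cong₂ ℚ._*_
    (cong (λ k → seq (p b ^ k) n) (count-≡ b u)) (powers-∷-∉ b u n L b∉))
    (ℚP.*-assoc (letter n b) (seq (p b ^ count u b) n) (powers (count u) L n))
  powers-∷-∈ b u n (a ∷ L) (a∉ ∷ uniq) (there b∈) = trans (cong₂ ℚ._*_
    (cong (λ k → seq (p a ^ k) n) (count-≢ u (All.lookup a∉ b∈))) (powers-∷-∈ b u n L uniq b∈))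
    (lem (seq (p a ^ count u a) n) (letter n b) (powers (count u) L n))
    where
    lem : ∀ x y z → x ℚ.* (y ℚ.* z) ≡ y ℚ.* (x ℚ.* z)
    lem = +-*-Solver.solve 3 (λ x y z → x :* (y :* z) := y :* (x :* z)) refl
      where open +-*-Solver

  powers≡weight : ∀ u n → powers (count u) (allFin q) n ≡ weight u n
  powers≡weight []      n = ones (allFin q)
    where
    ones : ∀ L → powers (count []) L n ≡ 1ℚ
    ones []      = refl
    ones (a ∷ L) = trans (ℚP.*-identityˡ _) (ones L)
  powers≡weight (b ∷ u) n = trans (powers-∷-∈ b u n (allFin q) (allFin⁺ q) (∈-allFin b))
    (cong (letter n b ℚ.*_) (powers≡weight u n))

uniform-lower-bound : ∀ {q} (s : ℕ → Fin q → ℚ) →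
  (∀ a → ∃[ δ ] (0ℚ ℚ.< δ × Eventually λ n → δ ℚ.≤ s n a)) →
  ∃[ δ ] (0ℚ ℚ.< δ × Eventually λ n → ∀ a → δ ℚ.≤ s n a)
uniform-lower-bound {zero}  s h = 1ℚ , ℚP.positive⁻¹ 1ℚ , 0 , λ _ _ ()
uniform-lower-bound {suc q} s h = combine (h Fin.zero) (uniform-lower-bound (λ n → s n ∘ Fin.suc) (h ∘ Fin.suc))
  where
  combine : ∃[ δ ] (0ℚ ℚ.< δ × Eventually λ n → δ ℚ.≤ s n Fin.zero) →
            ∃[ δ ] (0ℚ ℚ.< δ × Eventually λ n → ∀ a → δ ℚ.≤ s n (Fin.suc a)) →
            ∃[ δ ] (0ℚ ℚ.< δ × Eventually λ n → ∀ a → δ ℚ.≤ s n a)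
  combine (δ , 0<δ , ev) (δ′ , 0<δ′ , ev′) = δ ℚ.⊓ δ′ , 0<δ⊓δ′ ,
    eventually-map₂ (λ { n x y Fin.zero    → ℚP.≤-trans (ℚP.p⊓q≤p δ δ′) x
                       ; n x y (Fin.suc a) → ℚP.≤-trans (ℚP.p⊓q≤q δ δ′) (y a) }) ev ev′
    where
    0<δ⊓δ′ : 0ℚ ℚ.< δ ℚ.⊓ δ′
    0<δ⊓δ′ with ℚP.⊓-sel δ δ′
    ... | inj₁ e = subst (0ℚ ℚ.<_) (sym e) 0<δ
    ... | inj₂ e = subst (0ℚ ℚ.<_) (sym e) 0<δ′

-- Words without aligned occurrences of w

module Blocks {q} (em : ExcludedMiddle 0ℓ) (c : Config q) (b : ℤ) (w : Word q) where
  open Weights {q}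

  -- The cylinder condition freed from integer positions, so that moving along the word is
  -- composition with `suc`.
  Matches : (ℕ → Fin q) → Word q → Set
  Matches f u = ∀ (k : Fin (length u)) → f (toℕ k) ≡ lookup u k

  matches-++ : ∀ f u v → Matches f u → Matches (λ k → f (length u ℕ.+ k)) v → Matches f (u ++ v)
  matches-++ f []      v _  fv          = fv
  matches-++ f (a ∷ u) v fu fv Fin.zero    = fu Fin.zero
  matches-++ f (a ∷ u) v fu fv (Fin.suc k) = matches-++ (f ∘ suc) u v (fu ∘ Fin.suc) fv k

  +-pos-assoc : ∀ x n k → b ℤ.+ + x ℤ.+ + (n ℕ.+ k) ≡ b ℤ.+ + (x ℕ.+ n) ℤ.+ + k
  +-pos-assoc x n k = trans (cong (ℤ._+_ (b ℤ.+ + x)) (ℤP.pos-+ n k))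
    (trans (sym (ℤP.+-assoc (b ℤ.+ + x) (+ n) (+ k)))
    (cong (ℤ._+ + k) (trans (ℤP.+-assoc b (+ x) (+ n)) (cong (ℤ._+_ b) (sym (ℤP.pos-+ x n))))))

  ∈-others : ∀ v → length v ≡ length w → v ≢ w → v Membership.∈ others w
  ∈-others v |v|≡|w| v≢w = ∈-filter⁺ (λ v → ¬? (v ≟ʷ w)) (subst (λ n → v Membership.∈ words n) |v|≡|w| (∈-words v)) v≢w

  -- Block by block from offset x: a block equal to w is an occurrence, and otherwise the block is
  -- prepended to the avoiding word of the rest. Offsets are relative to b, which will be the left
  -- end of the window.
  occurs-or-avoids : ∀ n x →
    (∃[ y ] (x ℕ.≤ y × y ℕ.+ length w ℕ.≤ x ℕ.+ n ℕ.* length w × c ∈ [ w ]at (b ℤ.+ + y)))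
    ⊎ (∃[ v ] (v Membership.∈ avoiding w n × c ∈ [ v ]at (b ℤ.+ + x)))
  occurs-or-avoids zero    x = inj₂ ([] , here refl , λ ())
  occurs-or-avoids (suc n) x = first (read c (b ℤ.+ + x) (length w) ≟ʷ w) (occurs-or-avoids n (x ℕ.+ length w))
    where
    M = length w
    v = read c (b ℤ.+ + x) M
    |v| : length v ≡ M
    |v| = length-read c (b ℤ.+ + x) M
    first : Dec (v ≡ w) →
      (∃[ y ] (x ℕ.+ M ℕ.≤ y × y ℕ.+ M ℕ.≤ x ℕ.+ M ℕ.+ n ℕ.* M × c ∈ [ w ]at (b ℤ.+ + y)))
      ⊎ (∃[ v ] (v Membership.∈ avoiding w n × c ∈ [ v ]at (b ℤ.+ + (x ℕ.+ M)))) →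
      (∃[ y ] (x ℕ.≤ y × y ℕ.+ M ℕ.≤ x ℕ.+ suc n ℕ.* M × c ∈ [ w ]at (b ℤ.+ + y)))
      ⊎ (∃[ v ] (v Membership.∈ avoiding w (suc n) × c ∈ [ v ]at (b ℤ.+ + x)))
    first (yes v≡w) _ = inj₁ (x , ℕP.≤-refl , ℕP.+-monoʳ-≤ x (ℕP.m≤m+n M (n ℕ.* M))
      , subst (λ u → c ∈ [ u ]at (b ℤ.+ + x)) v≡w (∈-read c (b ℤ.+ + x) M))
    first (no _) (inj₁ (y , x+M≤y , y+M≤ , c∈)) = inj₁ (y , ℕP.≤-trans (ℕP.m≤m+n x M) x+M≤y
      , subst (y ℕ.+ M ℕ.≤_) (ℕP.+-assoc x M (n ℕ.* M)) y+M≤ , c∈)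
    first (no v≢w) (inj₂ (t , t∈ , c∈)) = inj₂ (v ++ t
      , ∈-cartesianProductWith⁺ _++_ (∈-others v |v| v≢w) t∈
      , matches-++ (λ k → c (b ℤ.+ + x ℤ.+ + k)) v t (∈-read c (b ℤ.+ + x) M)
          (λ k → trans (cong c (trans (cong (λ z → b ℤ.+ + x ℤ.+ + (z ℕ.+ toℕ k)) |v|) (+-pos-assoc x M (toℕ k)))) (c∈ k)))

-- Persistence and vanishing under a complete Bernoulli measure

sum-≼-∑ : ∀ {A : Set} (f : A → ℝ) (g : A → ℕ → ℚ) → (∀ x → seq (f x) ≼ g x) →
          ∀ L → seq (sum (List.map f L)) ≼ (λ n → ∑ (λ x → g x n) L)
sum-≼-∑ f g f≼g []      = ≼-refl
sum-≼-∑ f g f≼g (x ∷ L) = ⊕-mono-≼ (f≼g x) (sum-≼-∑ f g f≼g L)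

module CompleteBernoulli {q} (em : ExcludedMiddle 0ℓ) (μ : ProbabilityMeasure q)
                         (p : Fin q → ℝ) (bernoulli : IsBernoulli μ p) (complete : Complete p) where
  open Weights {q}
  open BernoulliWeights p
  open MeasureProperties em μ
  open IsBernoulli bernoulli

  cylinder≈weight : ∀ u j → ∣ cylinder u j ∣ᵐ ≈ weight u
  cylinder≈weight u j = ≈-trans
    (≃⇒≈ {measure μ (cylinder u j)} {product (List.map (λ a → p a ^ count u a) (allFin q))} (cylinders u j))
    (≗⇒≼ (powers≡weight u) , ≗⇒≼ (λ n → sym (powers≡weight u n)))

  letters-bounded : ∃[ δ ] (0ℚ ℚ.< δ × Eventually λ n → ∀ a → δ ℚ.≤ letter n a)
  letters-bounded = uniform-lower-bound letter λ a →
    let (δ , 0<δ , N , h) = complete a in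
    δ , 0<δ , N , λ n N≤n → ℚP.<⇒≤ (subst (ℚ._< letter n a) (ℚP.+-identityˡ δ) (h n N≤n))

  letters-sum : ∀ κ → 0ℚ ℚ.< κ → Eventually λ n → ∑ (letter n) (allFin q) ℚ.≤ 1ℚ ℚ.+ κ
  letters-sum κ 0<κ = eventually-map
    (λ n h → ℚP.<⇒≤ (subst (ℚ._< 1ℚ ℚ.+ κ) (seq-sum p (allFin q) n) h))
    (below (proj₁ (≃⇒≈ {sum (List.map p (allFin q))} {1ℝ} p-sum)) κ 0<κ)

  weight-positive : ∀ u → ∃[ κ ] (0ℚ ℚ.< κ × Eventually λ n → κ ℚ.≤ weight u n)
  weight-positive u = let (δ , 0<δ , ev) = letters-bounded in
    δ ^^ length u , ^^-pos (length u) 0<δ , eventually-map (λ n δ≤ → W-bound (ℚP.<⇒≤ 0<δ) δ≤ u) ev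

  avoiding-negligible : ∀ w ε → 0ℚ ℚ.< ε →
    ∃[ K ] (Eventually λ n → ∑ (λ v → weight v n) (avoiding w K) ℚ.< ε)
  avoiding-negligible w ε 0<ε = K , eventually-map₂ bound bounded (letters-sum _ (½^>0 (length w ℕ.* 2 ℕ.+ k)))
    where
    δ = proj₁ letters-bounded
    0<δ : 0ℚ ℚ.< δ
    0<δ = proj₁ (proj₂ letters-bounded)
    bounded : Eventually λ n → ∀ a → δ ℚ.≤ letter n a
    bounded = proj₂ (proj₂ letters-bounded)
    θ = ½ ℚ.* δ ^^ length w
    0<θ : 0ℚ ℚ.< θ
    0<θ = half-pos (^^-pos (length w) 0<δ)
    -- k sets the precision demanded of the sum of the letter weights, so that the error over words
    -- of length |w| stays below θ.
    k = proj₁ (½^-small θ 0<θ)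
    K = proj₁ (^^-vanishes θ ε 0<θ 0<ε)
    bound : ∀ n → (∀ a → δ ℚ.≤ letter n a) →
            ∑ (letter n) (allFin q) ℚ.≤ 1ℚ ℚ.+ ½^ (length w ℕ.* 2 ℕ.+ k) →
            ∑ (λ v → weight v n) (avoiding w K) ℚ.< ε
    bound n δ≤ T≤ = subst (ℚ._< ε) (sym (∑-avoiding (letter n) w K))
      (proj₂ (^^-vanishes θ ε 0<θ 0<ε) (∑ (W (letter n)) (others w))
        (∑-nonNeg (W (letter n)) (others w) (W-nonNeg λ a → ℚP.≤-trans (ℚP.<⇒≤ 0<δ) (δ≤ a)))
        (∑-others k w (ℚP.<⇒≤ 0<δ) δ≤ (ℚP.<⇒≤ (proj₂ (½^-small θ 0<θ))) T≤))

  module _ (𝓐 : CellularAutomaton q) where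
    open Dynamics 𝓐
    open Measurability {q} using (steps-measurable)

    preimage : ∀ n u → Borel (λ c → steps 𝓐 n c ∈ [ u ]at (+ 0))
    preimage n u = steps-measurable 𝓐 n (cylinder u (+ 0))

    brick⇒persistent : ∀ u → IsBrick 𝓐 u → Persistent 𝓐 μ u
    brick⇒persistent u (w , wall , s , n₀ , 1≤s , isBrick) vanishing =
      ℚP.<-irrefl refl (eventually-exists (eventually-map₂ {P = Lower} {Q = Upper} clash lower upper))
      where
      open IsWall wall
      -- Shifting by H brings `⟨ u ⟩` to the cylinder of u at 0; j is where the foot then starts.
      H = + ⌈ length u /2⌉
      j = ℤ.- + ⌈ length (w 0) /2⌉ ℤ.+ H
      κ = proj₁ (weight-positive (w 0))
      0<κ : 0ℚ ℚ.< κ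
      0<κ = proj₁ (proj₂ (weight-positive (w 0)))
      -- Half of κ: vanishing bounds the measure by η, while the foot keeps it above κ - η = η.
      η = ½ ℚ.* κ
      0<η = half-pos 0<κ
      close : Eventually λ n → Eventually λ i →
        ∣ preimage n u ∣ᵐ i ℚ.< 0ℚ ℚ.+ η × 0ℚ ℚ.< ∣ preimage n u ∣ᵐ i ℚ.+ η
      close = ⟶⇒≈ε {λ n → measure μ (preimage n u)} {0ℝ} vanishing η 0<η
      N = proj₁ close
      -- A time at which the wall shows u, beyond the threshold N. The factor `suc N` also makes it
      -- positive, as `propagates` requires.
      n = s ℕ.* suc N ℕ.+ n₀
      1+N≤n : suc N ℕ.≤ n
      1+N≤n = ℕP.≤-trans (subst (ℕ._≤ s ℕ.* suc N) (ℕP.*-identityˡ (suc N)) (ℕP.*-monoˡ-≤ (suc N) 1≤s))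
                         (ℕP.m≤m+n _ n₀)
      grows : ∀ c → c ∈ [ w 0 ]at j → steps 𝓐 n c ∈ [ u ]at (+ 0)
      grows c c∈ = cylinder-transfer (steps 𝓐 n c′) (steps 𝓐 n c) u (ℤ.- H) (+ 0)
        (subst (λ v → steps 𝓐 n c′ ∈ ⟨ v ⟩) (isBrick (suc N))
          (propagates c′ c′∈ n (ℕP.≤-trans (s≤s z≤n) 1+N≤n)))
        λ k _ → sym (trans (steps-shift c c′ H (λ _ → refl) n (ℤ.- H ℤ.+ + k))
          (cong (steps 𝓐 n c) (solve 2 (λ h k → :- h :+ k :+ h := con (+ 0) :+ k) refl H (+ k))))
        where
        open ℤSolver.+-*-Solver
        c′ : Config q
        c′ i = c (i ℤ.+ H)
        c′∈ : c′ ∈ ⟨ w 0 ⟩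
        c′∈ = cylinder-transfer c c′ (w 0) j (ℤ.- + ⌈ length (w 0) /2⌉) c∈ λ k _ →
          cong c (solve 3 (λ a k h → :- a :+ k :+ h := :- a :+ h :+ k) refl
            (+ ⌈ length (w 0) /2⌉) (+ k) H)
      Lower Upper : ℕ → Set
      Lower i = κ ℚ.< ∣ preimage n u ∣ᵐ i ℚ.+ η
      Upper i = ∣ preimage n u ∣ᵐ i ℚ.< 0ℚ ℚ.+ η
      lower : Eventually Lower
      lower = eventually-map₂ {P = λ i → κ ℚ.≤ weight (w 0) i}
        (λ _ → ℚP.≤-<-trans) (proj₂ (proj₂ (weight-positive (w 0))))
        (below (≼-trans (proj₂ (cylinder≈weight (w 0) j))
          (measure-mono (cylinder (w 0) j) (preimage n u) (λ {c} → grows c))) η 0<η)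
      upper : Eventually Upper
      upper = eventually-map (λ _ → proj₁) (proj₂ close n (ℕP.≤-trans (ℕP.n≤1+n N) 1+N≤n))
      clash : ∀ i → Lower i → Upper i → κ ℚ.< κ
      clash i l h = subst (κ ℚ.<_) (trans (cong (ℚ._+ η) (ℚP.+-identityˡ η)) (halves κ))
        (ℚP.<-trans l (ℚP.+-monoˡ-< η h))

    module _ (u : Word q) (u≢[] : u ≢ []) (¬brick : ¬ IsBrick 𝓐 u)
             (w : Word q) (m : ℕ) (blocking : Blocking w m) (m<w : m ℕ.< length w) where

      -- Offsets count from the left end -Y of the window: offset 0 starts the K blocks before u,
      -- and offset Y + |u| the K blocks after it.
      bad : ℕ → List (Word q × ℤ)
      bad K = List.map (λ v → v , ℤ.- + Y ℤ.+ + 0) (avoiding w K)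
           ++ List.map (λ v → v , ℤ.- + Y ℤ.+ + (Y ℕ.+ length u)) (avoiding w K)
        where Y = K ℕ.* length w

      weight-bad : ∀ K n → ∑ (λ (v , _) → weight v n) (bad K) ≡
        ∑ (λ v → weight v n) (avoiding w K) ℚ.+ ∑ (λ v → weight v n) (avoiding w K)
      weight-bad K n = trans (∑-++ (λ (v , _) → weight v n) (List.map _ (avoiding w K)) (List.map _ (avoiding w K)))
        (cong₂ ℚ._+_ (∑-map (λ (v , _) → weight v n) _ (avoiding w K))
                     (∑-map (λ (v , _) → weight v n) _ (avoiding w K)))

      ∈-bad : ∀ K n → q ℕ.^ (K ℕ.* length w ℕ.+ (length u ℕ.+ K ℕ.* length w)) ℕ.< n →
              ∀ c → steps 𝓐 n c ∈ [ u ]at (+ 0) → Any (λ (v , j) → c ∈ [ v ]at j) (bad K)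
      ∈-bad K n N<n c c∈ = decide (occurs-or-avoids K 0) (occurs-or-avoids K (Y ℕ.+ length u))
        where
        Y = K ℕ.* length w
        open Blocks em c (ℤ.- + Y) w
        open Bricks 𝓐 u u≢[] Y
        decide : _ → _ → Any (λ (v , j) → c ∈ [ v ]at j) (bad K)
        decide (inj₂ (v , v∈ , c∈v)) _ = AnyP.++⁺ˡ (AnyP.map⁺ (Membership.lose v∈ c∈v))
        decide (inj₁ _) (inj₂ (v , v∈ , c∈v)) =
          AnyP.++⁺ʳ (List.map _ (avoiding w K)) (AnyP.map⁺ (Membership.lose v∈ c∈v))
        decide (inj₁ (a , _ , a+w≤Y , c∈a)) (inj₁ (b , Y+u≤b , b+w≤P , c∈b)) =
          ⊥-elim (¬brick (determining⇒brick c
            (blocked⇒determining w m blocking m<w c a b a+w≤Y Y+u≤b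
              (subst (b ℕ.+ length w ℕ.≤_) (ℕP.+-assoc Y (length u) Y) b+w≤P) c∈a c∈b)
            n N<n c∈))

      ¬brick⇒vanishing : Vanishing 𝓐 μ u
      ¬brick⇒vanishing ε (e , 0<e , N₀ , e<ε) = suc (q ℕ.^ P) , λ n N<n →
        η , 0<η , eventually-map₂ {P = λ i → S i ℚ.< η} {Q = λ i → Small n i × e ℚ.< seq ε i}
          (λ i s< (s , e<) → estimate n i s< s e<)
          (proj₂ (avoiding-negligible w η 0<η))
          (eventually-map₂ {P = Small n} (λ _ → _,_) (small n N<n)
            (N₀ , λ i N₀≤i → subst (ℚ._< seq ε i) (ℚP.+-identityˡ e) (e<ε i N₀≤i)))
        where
        -- A quarter of e for each of four losses: the avoiding words on either side, the asymptotic
        -- comparison `≼`, and the margin that `_<_` on reals requires.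
        η = ½ ℚ.* (½ ℚ.* e)
        0<η : 0ℚ ℚ.< η
        0<η = half-pos (half-pos 0<e)
        K = proj₁ (avoiding-negligible w η 0<η)
        P = K ℕ.* length w ℕ.+ (length u ℕ.+ K ℕ.* length w)
        S : ℕ → ℚ
        S i = ∑ (λ v → weight v i) (avoiding w K)
        Small : ℕ → ℕ → Set
        Small n i = ∣ preimage n u ∣ᵐ i ℚ.< S i ℚ.+ S i ℚ.+ η × 0ℚ ℚ.< ∣ preimage n u ∣ᵐ i ℚ.+ η
        small : ∀ n → q ℕ.^ P ℕ.< n → Eventually (Small n)
        small n N<n = eventually-map₂
          (λ i a b → subst (λ z → ∣ preimage n u ∣ᵐ i ℚ.< z ℚ.+ η) (weight-bad K i) a , b)
          (below (≼-trans (measure-cover (bad K) (preimage n u) (∈-bad K n N<n))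
            (sum-≼-∑ (λ (v , j) → measure μ (cylinder v j)) (λ (v , _) → weight v)
              (λ (v , j) → proj₁ (cylinder≈weight v j)) (bad K))) η 0<η)
          (below (0≼measure (preimage n u)) η 0<η)
        4η≡e : η ℚ.+ η ℚ.+ (η ℚ.+ η) ≡ e
        4η≡e = trans (cong₂ ℚ._+_ (halves (½ ℚ.* e)) (halves (½ ℚ.* e))) (halves e)
        3η+η≡e : η ℚ.+ η ℚ.+ η ℚ.+ η ≡ e
        3η+η≡e = trans (ℚP.+-assoc (η ℚ.+ η) η η) 4η≡e
        estimate : ∀ n i → S i ℚ.< η → Small n i → e ℚ.< seq ε i →
                   ∣ ∣ preimage n u ∣ᵐ i ℚ.- 0ℚ ∣ ℚ.+ η ℚ.< seq ε i
        estimate n i S<η (m< , 0<) e<ε = ℚP.<-trans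
          (subst (∣ x ℚ.- 0ℚ ∣ ℚ.+ η ℚ.<_) 3η+η≡e (ℚP.+-monoˡ-< η
            (∣p∣<q (subst (ℚ._< 3η) (sym (ℚP.+-identityʳ x)) x<3η) (subst (λ z → ℚ.- z ℚ.< 3η) (sym (ℚP.+-identityʳ x)) -x<3η))))
          e<ε
          where
          x = ∣ preimage n u ∣ᵐ i
          3η = η ℚ.+ η ℚ.+ η
          x<3η : x ℚ.< 3η
          x<3η = ℚP.<-trans m< (ℚP.+-monoˡ-< η (ℚP.+-mono-< S<η S<η))
          -x<η : ℚ.- x ℚ.< η
          -x<η = subst₂ ℚ._<_ (ℚP.+-identityˡ (ℚ.- x)) (trans (cong (ℚ._- x) (ℚP.+-comm x η)) (p+q-q≡p η x))
            (ℚP.+-monoˡ-< (ℚ.- x) 0<)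
          η<3η : η ℚ.< 3η
          η<3η = subst (ℚ._< 3η) (ℚP.+-identityˡ η) (ℚP.+-monoˡ-< η (ℚP.+-mono-< 0<η 0<η))
          -x<3η : ℚ.- x ℚ.< 3η
          -x<3η = ℚP.<-trans -x<η η<3η

mainTheorem1 : ExcludedMiddle 0ℓ →
    ∀ {q : ℕ} (𝓐 : CellularAutomaton q) → ¬ Sensitive 𝓐 →
    ∀ (μ : ProbabilityMeasure q) (p : Fin q → ℝ) → IsBernoulli μ p → Complete p →
    ∀ (u : Word q) → u ≢ [] → (Persistent 𝓐 μ u ⇔ IsBrick 𝓐 u)
mainTheorem1 em 𝓐 ¬sens μ p bernoulli complete u u≢[] = mk⇔
  (λ persistent → ¬¬-elim λ ¬brick →
    let (w , m , blocking , m<w) = blocking-word in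
    persistent (¬brick⇒vanishing 𝓐 u u≢[] ¬brick w m blocking m<w))
  (brick⇒persistent 𝓐 u)
  where
  open NonSensitivity em 𝓐 ¬sens
  open CompleteBernoulli em μ p bernoulli complete
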